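{- Every $2$-layer $5$-planar graph on $n\ge 3$ vertices has at most $\frac{9}{4}n-\frac{9}{2}$ edges, except for the graph $\mathcal{S}$ (up to isomorphism), which has $8$ vertices and $14$ edges.
   Context: All graphs are finite and simple (no loops or parallel edges). A topological $2$-layer graph is a bipartite graph $G=(U\,\dot\cup\,V,E)$, $E\subseteq U\times V$, drawn in the plane so that the vertices of $U$ and of $V$ are distinct points on two horizontal lines $L_u$ and $L_v$, respectively, and edges are $y$-monotone Jordan arcs; the drawing is assumed simple, i.e. adjacent edges do not cross and independent edges cross at most once. Denote the vertices by $u_1,\dots,u_p$ along $L_u$ and $v_1,\dots,v_q$ along $L_v$ in left-to-right order, $n=p+q$. (Thus edges $(u_i,v_x)$ and $(u_j,v_y)$ with $i<j$ cross if and only if $x>y$.) A topological $2$-layer graph is $k$-planar if each edge is crossed at most $k$ times. A bipartite graph is $2$-layer $k$-planar if it is isomorphic to the underlying abstract graph of some topological $2$-layer $k$-planar graph. The graph $\mathcal{S}$ has vertices $u_1,u_2,u_3,u_4,v_1,v_2,v_3,v_4$ and is obtained from the complete bipartite graph $K_{4,4}$ on $\{u_1,\dots,u_4\}$ and $\{v_1,\dots,v_4\}$ by deleting the two edges $(u_1,v_4)$ and $(u_4,v_1)$; it is $2$-layer $5$-planar when drawn with these vertex orders. -}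

module Defs where

open import Data.Bool.Base using (Bool; true; false; T)
open import Data.Bool.Properties using (T?)
open import Data.Fin.Base using (Fin; _<_; splitAt)
open import Data.Fin.Patterns using (0F; 3F)
open import Data.Fin.Permutation using (Permutation; _⟨$⟩ʳ_)
open import Data.Fin.Properties using (_<?_)
open import Data.List.Base using (List; allFin; cartesianProduct; filter; length)
open import Data.Nat.Base as ℕ using (ℕ; _+_)
open import Data.Product.Base using (Σ-syntax; ∃-syntax; _×_; _,_)
open import Data.Sum.Base using (_⊎_; inj₁; inj₂)
open import Relation.Binary.Definitions using (Decidable)
open import Relation.Binary.PropositionalEquality using (_≡_; refl)
open import Relation.Nullary.Decidable using (_×-dec_; _⊎-dec_)

record Graph (n : ℕ) : Set where
  field
    adj    : Fin n → Fin n → Bool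
    sym    : ∀ a b → adj a b ≡ adj b a
    irrefl : ∀ a → adj a a ≡ false

open Graph public using (adj)

-- Each edge {a , b} is counted once, as the pair with a < b.
edgeCount : ∀ {n} → Graph n → ℕ
edgeCount {n} G =
  length (filter (λ (a , b) → (a <? b) ×-dec T? (adj G a b))
                 (cartesianProduct (allFin n) (allFin n)))

infix 4 _≅_

_≅_ : ∀ {m n} → Graph m → Graph n → Set
_≅_ {m} {n} G H =
  Σ[ σ ∈ Permutation m n ] (∀ a b → adj G a b ≡ adj H (σ ⟨$⟩ʳ a) (σ ⟨$⟩ʳ b))

-- A topological 2-layer graph, up to the data that determines its crossings:
-- the indices in Fin p and Fin q are the left-to-right positions on the two
-- lines, and E u v says whether (u , v) is an edge.  In a simple drawing with
-- y-monotone edges, two edges cross (then exactly once) if and only if their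
-- endpoints occur in opposite orders on the two lines, so the arcs themselves
-- need not be recorded.
record TwoLayer (p q : ℕ) : Set where
  constructor twoLayer
  field
    E : Fin p → Fin q → Bool

  edges : List (Fin p × Fin q)
  edges = filter (λ (u , v) → T? (E u v)) (cartesianProduct (allFin p) (allFin q))

open TwoLayer public

Cross : ∀ {p q} → Fin p × Fin q → Fin p × Fin q → Set
Cross (i , x) (j , y) = (i < j × y < x) ⊎ (j < i × x < y)

cross? : ∀ {p q} → Decidable (Cross {p} {q})
cross? (i , x) (j , y) = ((i <? j) ×-dec (y <? x)) ⊎-dec ((j <? i) ×-dec (x <? y))

crossings : ∀ {p q} → TwoLayer p q → Fin p × Fin q → ℕ
crossings D e = length (filter (cross? e) (edges D))

IsPlanar : ∀ {p q} → ℕ → TwoLayer p q → Set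
IsPlanar k D = ∀ u v → T (E D u v) → crossings D (u , v) ℕ.≤ k

-- The underlying abstract graph: u₁,…,u_p come first, followed by v₁,…,v_q.
underlying : ∀ {p q} → TwoLayer p q → Graph (p + q)
underlying {p} {q} D = record
  { adj    = λ a b → adj⊎ (splitAt p a) (splitAt p b)
  ; sym    = λ a b → adj⊎-sym (splitAt p a) (splitAt p b)
  ; irrefl = λ a → adj⊎-irrefl (splitAt p a)
  }
  where
  adj⊎ : Fin p ⊎ Fin q → Fin p ⊎ Fin q → Bool
  adj⊎ (inj₁ u) (inj₂ v) = E D u v
  adj⊎ (inj₂ v) (inj₁ u) = E D u v
  adj⊎ (inj₁ _) (inj₁ _) = false
  adj⊎ (inj₂ _) (inj₂ _) = false

  adj⊎-sym : ∀ s t → adj⊎ s t ≡ adj⊎ t s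
  adj⊎-sym (inj₁ _) (inj₁ _) = refl
  adj⊎-sym (inj₁ _) (inj₂ _) = refl
  adj⊎-sym (inj₂ _) (inj₁ _) = refl
  adj⊎-sym (inj₂ _) (inj₂ _) = refl

  adj⊎-irrefl : ∀ s → adj⊎ s s ≡ false
  adj⊎-irrefl (inj₁ _) = refl
  adj⊎-irrefl (inj₂ _) = refl

-- Bipartiteness of G is implied by the isomorphism.
IsTwoLayerPlanar : ∀ {n} → ℕ → Graph n → Set
IsTwoLayerPlanar k G =
  ∃[ p ] ∃[ q ] Σ[ D ∈ TwoLayer p q ] (IsPlanar k D × G ≅ underlying D)

-- K₄,₄ without the edges (u₁ , v₄) and (u₄ , v₁).
𝒮-edge : Fin 4 → Fin 4 → Bool
𝒮-edge 0F 3F = false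
𝒮-edge 3F 0F = false
𝒮-edge _  _  = true

𝒮 : Graph 8
𝒮 = underlying (twoLayer 𝒮-edge)

{-# OPTIONS --safe #-}
-- Read a drawing as a 0/1 matrix with p rows and q columns: two edges cross
-- when one entry lies strictly south-west of the other.  Merging two
-- consecutive rows (or columns) creates no crossing and loses one edge per
-- common entry, so in a minimal counterexample consecutive rows and consecutive
-- columns share at least three entries (a merge that gives 𝒮 is excluded by
-- inspecting the 5 × 4 matrices that arise by splitting a row of 𝒮).
-- This leaves so little freedom that the first rows can be enumerated: each
-- new row reaches at most three columns further than the earlier ones, and
-- within a few rows either some entry must be crossed more than five times, or
-- c rows and c columns at the top left corner carry at most 9/4 · 2c edges and
-- can be removed by induction, or the matrix ends and satisfies the bound or
-- is 𝒮.
module Submission where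

open import Defs
open import Data.Bool.Base using (Bool; true; false; T; not; _∧_; _∨_; _xor_; if_then_else_)
open import Data.Bool.ListAction using (all)
open import Data.Bool.Properties using (T-∧; T-∨; T?; ∧-comm; ∨-comm)
  renaming (_≟_ to _≟ᵇ_)
open import Data.Empty using (⊥-elim)
open import Data.Fin.Base as Fin using (Fin; toℕ; fromℕ<; splitAt; _↑ˡ_; _↑ʳ_)
open import Data.Fin.Permutation using (_⟨$⟩ʳ_; ↔⇒≡) renaming (id to idᵖ)
open import Data.Fin.Properties
  using (toℕ<n; fromℕ<-toℕ; toℕ-fromℕ<; splitAt-↑ˡ; splitAt-↑ʳ; all?; toℕ-injective)
open import Data.List.Base
  using (List; []; _∷_; _++_; map; length; filter; cartesianProduct; allFin; tabulate)
open import Data.List.Membership.Propositional using (_∈_)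
open import Data.List.Membership.Propositional.Properties using (∈-map⁺; ∈-++⁺ˡ; ∈-++⁺ʳ)
open import Data.List.Properties using (map-tabulate; map-++; map-∘)
open import Data.List.Relation.Unary.Any using (here; there)
open import Data.Nat.Base hiding (_/_)
open import Data.Nat.ListAction using () renaming (sum to sumˡ)
open import Data.Nat.ListAction.Properties using (sum-++)
open import Data.Nat.Properties
open import Data.Nat.Solver using (module +-*-Solver)
open import Data.Product.Base using (∃-syntax; _×_; _,_; proj₁; proj₂)
open import Data.Sum.Base using (_⊎_; inj₁; inj₂)
open import Data.Unit.Base using (tt)
open import Function.Base using (_∘_; case_of_; flip; id)
open import Function.Bundles using (Equivalence)
open import Relation.Binary.PropositionalEquality
open import Relation.Nullary.Decidable
  using (yes; no; does; toWitness; toWitnessFalse; _→-dec_)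
open import Relation.Nullary.Negation using (¬_; contradiction)
open import Relation.Unary using (Decidable)
open import Algebra.Properties.CommutativeMonoid.Sum +-0-commutativeMonoid
  using (sum; sum-cong-≗; ∑-distrib-+; ∑-comm; sum-permute)
open import Algebra.Properties.CommutativeSemigroup +-commutativeSemigroup using (interchange)
open +-*-Solver using (solve; con; _:+_; _:*_; _:=_)

-- Truth values, finite sums and bounded search

∧⁻ : ∀ {a b} → T (a ∧ b) → T a × T b
∧⁻ = Equivalence.to T-∧

∧⁺ : ∀ {a b} → T a → T b → T (a ∧ b)
∧⁺ s t = Equivalence.from T-∧ (s , t)

∨⁻ : ∀ {a b} → T (a ∨ b) → T a ⊎ T b
∨⁻ = Equivalence.to T-∨

∨⁺ : ∀ {a b} → T a ⊎ T b → T (a ∨ b)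
∨⁺ = Equivalence.from T-∨

not⁻ : ∀ {b} → T (not b) → ¬ T b
not⁻ {false} _ ()

xor-≡ : ∀ {a b} → ¬ T (a xor b) → a ≡ b
xor-≡ {true}  {true}  _ = refl
xor-≡ {true}  {false} f = ⊥-elim (f tt)
xor-≡ {false} {true}  f = ⊥-elim (f tt)
xor-≡ {false} {false} _ = refl

xor-≢ : ∀ {a b} → T (a xor b) → a ≢ b
xor-≢ {true}  {false} _ ()
xor-≢ {false} {true}  _ ()

⟦_⟧ : Bool → ℕ
⟦ true ⟧  = 1
⟦ false ⟧ = 0

⟦⟧-mono : ∀ {a b} → (T a → T b) → ⟦ a ⟧ ≤ ⟦ b ⟧
⟦⟧-mono {false}         _ = z≤n
⟦⟧-mono {true}  {true}  _ = ≤-refl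
⟦⟧-mono {true}  {false} f = ⊥-elim (f tt)

⟦⟧≤1 : ∀ b → ⟦ b ⟧ ≤ 1
⟦⟧≤1 true  = ≤-refl
⟦⟧≤1 false = z≤n

⟦⟧≡0 : ∀ {b} → ¬ T b → ⟦ b ⟧ ≡ 0
⟦⟧≡0 {true}  f = ⊥-elim (f tt)
⟦⟧≡0 {false} _ = refl

⟦∨⟧+⟦∧⟧ : ∀ a b → ⟦ a ⟧ + ⟦ b ⟧ ≡ ⟦ a ∨ b ⟧ + ⟦ a ∧ b ⟧
⟦∨⟧+⟦∧⟧ true  b = refl
⟦∨⟧+⟦∧⟧ false b = sym (+-identityʳ ⟦ b ⟧)

∑ : ℕ → (ℕ → ℕ) → ℕ
∑ zero    f = 0
∑ (suc n) f = f 0 + ∑ n (f ∘ suc)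

∑-cong : ∀ n {f g} → (∀ i → i < n → f i ≡ g i) → ∑ n f ≡ ∑ n g
∑-cong zero    _   = refl
∑-cong (suc n) f≡g = cong₂ _+_ (f≡g 0 z<s) (∑-cong n λ i i<n → f≡g (suc i) (s<s i<n))

∑-mono : ∀ n {f g} → (∀ i → i < n → f i ≤ g i) → ∑ n f ≤ ∑ n g
∑-mono zero    _   = z≤n
∑-mono (suc n) f≤g = +-mono-≤ (f≤g 0 z<s) (∑-mono n λ i i<n → f≤g (suc i) (s<s i<n))

∑-const : ∀ n c → ∑ n (λ _ → c) ≡ n * c
∑-const zero    c = refl
∑-const (suc n) c = cong (c +_) (∑-const n c)

∑-zero : ∀ n {f} → (∀ i → i < n → f i ≡ 0) → ∑ n f ≡ 0
∑-zero n f≡0 = trans (∑-cong n f≡0) (trans (∑-const n 0) (*-zeroʳ n))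

∑-+ : ∀ n f g → ∑ n (λ i → f i + g i) ≡ ∑ n f + ∑ n g
∑-+ zero    f g = refl
∑-+ (suc n) f g = trans (cong (f 0 + g 0 +_) (∑-+ n (f ∘ suc) (g ∘ suc)))
                        (interchange (f 0) (g 0) _ _)

∑-swap : ∀ m n (f : ℕ → ℕ → ℕ) → ∑ m (λ i → ∑ n (f i)) ≡ ∑ n (λ j → ∑ m (λ i → f i j))
∑-swap zero    n f = sym (∑-zero n λ _ _ → refl)
∑-swap (suc m) n f = trans (cong (∑ n (f 0) +_) (∑-swap m n (f ∘ suc)))
                           (sym (∑-+ n (f 0) _))

∑-split : ∀ m n f → ∑ (m + n) f ≡ ∑ m f + ∑ n (f ∘ (m +_))
∑-split zero    n f = refl
∑-split (suc m) n f = trans (cong (f 0 +_) (∑-split m n (f ∘ suc))) (sym (+-assoc (f 0) _ _))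

∑-last : ∀ n f → ∑ (suc n) f ≡ ∑ n f + f n
∑-last zero    f = +-identityʳ (f 0)
∑-last (suc n) f = trans (cong (f 0 +_) (∑-last n (f ∘ suc))) (sym (+-assoc (f 0) _ _))

∑-range : ∀ {m n} f → m ≤ n → ∑ m f ≤ ∑ n f
∑-range f z≤n       = z≤n
∑-range f (s≤s m≤n) = +-monoʳ-≤ (f 0) (∑-range (f ∘ suc) m≤n)

∑-support : ∀ {m n} f → m ≤ n → (∀ i → m ≤ i → f i ≡ 0) → ∑ n f ≡ ∑ m f
∑-support {n = n} f z≤n f≡0 = ∑-zero n (λ i _ → f≡0 i z≤n)
∑-support f (s≤s m≤n) f≡0 =
  cong (f 0 +_) (∑-support (f ∘ suc) m≤n λ i m≤i → f≡0 (suc i) (s≤s m≤i))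

anyᵇ : ℕ → (ℕ → Bool) → Bool
anyᵇ zero    P = false
anyᵇ (suc n) P = P 0 ∨ anyᵇ n (P ∘ suc)

anyᵇ⁻ : ∀ n {P} → T (anyᵇ n P) → ∃[ i ] i < n × T (P i)
anyᵇ⁻ (suc n) {P} t with ∨⁻ {P 0} t
... | inj₁ t₀ = 0 , z<s , t₀
... | inj₂ t₁ with i , i<n , tᵢ ← anyᵇ⁻ n t₁ = suc i , s<s i<n , tᵢ

anyᵇ⁺ : ∀ {n i P} → i < n → T (P i) → T (anyᵇ n P)
anyᵇ⁺ {suc n} {zero}  {P} _         t = ∨⁺ {P 0} (inj₁ t)
anyᵇ⁺ {suc n} {suc i} {P} (s≤s i<n) t = ∨⁺ {P 0} (inj₂ (anyᵇ⁺ i<n t))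

all⁻ : ∀ {A : Set} (P : A → Bool) {xs x} → T (all P xs) → x ∈ xs → T (P x)
all⁻ P t (here refl)  = proj₁ (∧⁻ t)
all⁻ P {y ∷ _} t (there x∈xs) = all⁻ P (proj₂ (∧⁻ {P y} t)) x∈xs

-- Drawings as matrices, crossings and the bound

Matrix : Set
Matrix = ℕ → ℕ → Bool

count : ℕ → ℕ → Matrix → ℕ
count p q e = ∑ p λ i → ∑ q λ x → ⟦ e i x ⟧

cross : ℕ → ℕ → ℕ → ℕ → Bool
cross i x j y = ((i <ᵇ j) ∧ (y <ᵇ x)) ∨ ((j <ᵇ i) ∧ (x <ᵇ y))

crossed : ℕ → ℕ → Matrix → ℕ → ℕ → ℕ
crossed p q e i x = count p q λ j y → cross i x j y ∧ e j y

-- Matrices are total on ℕ × ℕ, so merging, shifting and transposing need no casts; `inside`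
-- confines the entries to the p × q box.
record Planar (p q : ℕ) (e : Matrix) : Set where
  field
    inside : ∀ {i x} → T (e i x) → i < p × x < q
    sparse : ∀ {i x} → T (e i x) → crossed p q e i x ≤ 5

open Planar

rowShare : ℕ → Matrix → ℕ → ℕ
rowShare q e i = ∑ q λ x → ⟦ e i x ∧ e (suc i) x ⟧

colShare : ℕ → Matrix → ℕ → ℕ
colShare p e x = ∑ p λ i → ⟦ e i x ∧ e i (suc x) ⟧

𝒮-matrix : Matrix
𝒮-matrix 0 3 = false
𝒮-matrix 3 0 = false
𝒮-matrix _ _ = true

record Is𝒮 (p q : ℕ) (e : Matrix) : Set where
  field
    p≡4   : p ≡ 4
    q≡4   : q ≡ 4
    agree : ∀ {i x} → i < 4 → x < 4 → e i x ≡ 𝒮-matrix i x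

open Is𝒮

-- The bound m ≤ 9/4 n - 9/2 multiplied by four and freed of subtraction, where n = p + q.
Good : ℕ → ℕ → Matrix → Set
Good p q e = 4 * count p q e + 18 ≤ 9 * (p + q) ⊎ Is𝒮 p q e

-- Transport of crossings and transposition

cross-⇒ : ∀ i x j y i′ x′ j′ y′ → (i < j → i′ < j′) → (y < x → y′ < x′) →
          (j < i → j′ < i′) → (x < y → x′ < y′) → T (cross i x j y) → T (cross i′ x′ j′ y′)
cross-⇒ i x j y i′ x′ j′ y′ f g f′ g′ t with ∨⁻ {(i <ᵇ j) ∧ (y <ᵇ x)} t
... | inj₁ t₁ with s , s′ ← ∧⁻ {i <ᵇ j} t₁ =
      ∨⁺ {(i′ <ᵇ j′) ∧ (y′ <ᵇ x′)} (inj₁ (∧⁺ (<⇒<ᵇ (f (<ᵇ⇒< i j s))) (<⇒<ᵇ (g (<ᵇ⇒< y x s′)))))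
... | inj₂ t₂ with s , s′ ← ∧⁻ {j <ᵇ i} t₂ =
      ∨⁺ {(i′ <ᵇ j′) ∧ (y′ <ᵇ x′)} (inj₂ (∧⁺ (<⇒<ᵇ (f′ (<ᵇ⇒< j i s))) (<⇒<ᵇ (g′ (<ᵇ⇒< x y s′)))))

cross-sw : ∀ i x j y → i < j → y < x → T (cross i x j y)
cross-sw i x j y i<j y<x = ∨⁺ {(i <ᵇ j) ∧ (y <ᵇ x)} (inj₁ (∧⁺ (<⇒<ᵇ i<j) (<⇒<ᵇ y<x)))

cross-ne : ∀ i x j y → j < i → x < y → T (cross i x j y)
cross-ne i x j y j<i x<y = ∨⁺ {(i <ᵇ j) ∧ (y <ᵇ x)} (inj₂ (∧⁺ (<⇒<ᵇ j<i) (<⇒<ᵇ x<y)))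

count-cong : ∀ p q {e f : Matrix} → (∀ i x → i < p → x < q → e i x ≡ f i x) →
             count p q e ≡ count p q f
count-cong p q e≡f =
  ∑-cong p λ i i<p → ∑-cong q λ x x<q → cong ⟦_⟧ (e≡f i x i<p x<q)

count-mono : ∀ p q {e f : Matrix} → (∀ {i x} → i < p → x < q → T (e i x) → T (f i x)) →
             count p q e ≤ count p q f
count-mono p q e⇒f = ∑-mono p λ i i<p → ∑-mono q λ x x<q → ⟦⟧-mono (e⇒f i<p x<q)

crossed-cong : ∀ p q {e f : Matrix} → (∀ i x → i < p → x < q → e i x ≡ f i x) →
               ∀ i x → crossed p q e i x ≡ crossed p q f i x
crossed-cong p q e≡f i x =
  count-cong p q λ j y j<p y<q → cong (cross i x j y ∧_) (e≡f j y j<p y<q)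

flip-planar : ∀ {p q e} → Planar p q e → Planar q p (flip e)
flip-planar {p} {q} {e} D = record
  { inside = λ t → case inside D t of λ (i<p , x<q) → x<q , i<p
  ; sparse = λ {x} {i} t → ≤-trans (≤-reflexive (crossed-flip x i)) (sparse D t)
  }
  where
  crossed-flip : ∀ x i → crossed q p (flip e) x i ≡ crossed p q e i x
  crossed-flip x i = trans (∑-swap q p _) (count-cong p q λ j y _ _ →
    cong (_∧ e j y) (trans (cong₂ _∨_ (∧-comm (x <ᵇ y) (j <ᵇ i)) (∧-comm (y <ᵇ x) (i <ᵇ j)))
                           (∨-comm ((j <ᵇ i) ∧ (x <ᵇ y)) ((i <ᵇ j) ∧ (y <ᵇ x)))))

differs : ℕ → ℕ → Matrix → Matrix → Bool
differs p q e f = anyᵇ p λ i → anyᵇ q λ x → e i x xor f i x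

differs-≡ : ∀ p q e f → ¬ T (differs p q e f) → ∀ {i x} → i < p → x < q → e i x ≡ f i x
differs-≡ p q e f ¬d i<p x<q = xor-≡ λ t → ¬d (anyᵇ⁺ i<p (anyᵇ⁺ x<q t))

𝒮-symmetric : ∀ {i x} → i < 4 → x < 4 → 𝒮-matrix i x ≡ 𝒮-matrix x i
𝒮-symmetric = differs-≡ 4 4 𝒮-matrix (flip 𝒮-matrix) λ ()

-- Lets the arguments about rows serve for columns; the exceptional case survives because the matrix
-- of 𝒮 is symmetric.
flip-good : ∀ {p q e} → Good q p (flip e) → Good p q e
flip-good {p} {q} {e} (inj₁ h) =
  inj₁ (subst₂ _≤_ (cong (λ m → 4 * m + 18) (∑-swap q p _)) (cong (9 *_) (+-comm q p)) h)
flip-good (inj₂ s) = inj₂ record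
  { p≡4 = q≡4 s
  ; q≡4 = p≡4 s
  ; agree = λ i<4 x<4 → trans (agree s x<4 i<4) (𝒮-symmetric x<4 i<4)
  }

-- Rows as finite bit lists

infixl 9 _!_
_!_ : List Bool → ℕ → Bool
[]      ! _     = false
(b ∷ r) ! zero  = b
(b ∷ r) ! suc x = r ! x

!-length : ∀ r {x} → T (r ! x) → x < length r
!-length (b ∷ r) {zero}  _ = z<s
!-length (b ∷ r) {suc x} t = s<s (!-length r t)

-- Keeps rows free of trailing zeros, so that length is the exact width.
infixr 5 _∷ᵗ_
_∷ᵗ_ : Bool → List Bool → List Bool
false ∷ᵗ [] = []
b     ∷ᵗ r  = b ∷ r

∷ᵗ-! : ∀ b r x → (b ∷ᵗ r) ! x ≡ (b ∷ r) ! x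
∷ᵗ-! false []      zero    = refl
∷ᵗ-! false []      (suc x) = refl
∷ᵗ-! false (_ ∷ _) x       = refl
∷ᵗ-! true  r       x       = refl

rows : ℕ → List (List Bool)
rows zero    = [] ∷ []
rows (suc n) = map (false ∷ᵗ_) (rows n) ++ map (true ∷ᵗ_) (rows n)

trim : ℕ → (ℕ → Bool) → List Bool
trim zero    f = []
trim (suc n) f = f 0 ∷ᵗ trim n (f ∘ suc)

-- Makes a test over `rows n` exhaustive: whichever row occurs in the matrix, its trimmed list is
-- among those tested.
trim-∈ : ∀ n f → trim n f ∈ rows n
trim-∈ zero    f = here refl
trim-∈ (suc n) f with f 0
... | false = ∈-++⁺ˡ (∈-map⁺ (false ∷ᵗ_) (trim-∈ n (f ∘ suc)))
... | true  = ∈-++⁺ʳ (map (false ∷ᵗ_) (rows n)) (∈-map⁺ (true ∷ᵗ_) (trim-∈ n (f ∘ suc)))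

trim-! : ∀ n f → (∀ x → T (f x) → x < n) → ∀ x → trim n f ! x ≡ f x
trim-! zero    f f<n x with f x in eq
... | false = refl
... | true  = contradiction (f<n x (subst T (sym eq) tt)) λ ()
trim-! (suc n) f f<n zero    = ∷ᵗ-! (f 0) (trim n (f ∘ suc)) 0
trim-! (suc n) f f<n (suc x) =
  trans (∷ᵗ-! (f 0) (trim n (f ∘ suc)) (suc x))
        (trim-! n (f ∘ suc) (λ y t → s<s⁻¹ (f<n (suc y) t)) x)

trim-last : ∀ n f {x} → length (trim n f) ≡ suc x → T (f x)
trim-last (suc n) f {x} eq with f 0 in eq₀ | trim n (f ∘ suc) in eqₜ
trim-last (suc n) f {zero}  refl | true  | []    = subst T (sym eq₀) tt
trim-last (suc n) f {suc x} eq   | true  | _ ∷ _ =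
  trim-last n (f ∘ suc) (trans (cong length eqₜ) (suc-injective eq))
trim-last (suc n) f {suc x} eq   | false | _ ∷ _ =
  trim-last n (f ∘ suc) (trans (cong length eqₜ) (suc-injective eq))

-- A nonempty trimmed list ends in `true`, so its length is one more than the column of an actual
-- entry.
trim-length : ∀ n f {q} → (∀ x → T (f x) → x < q) → length (trim n f) ≤ q
trim-length n f f<q with length (trim n f) in eq
... | zero  = z≤n
... | suc x = f<q x (trim-last n f eq)

-- The search over initial rows

-- If consecutive columns share three rows, the rows after the first k have at
-- least this many entries in the columns before x.
missing : ℕ → Matrix → ℕ → ℕ
missing k e x = ∑ x λ y → 3 ∸ colShare k e y

northEast : ℕ → ℕ → Matrix → ℕ → ℕ
northEast k w e x = count k w λ j y → (x <ᵇ y) ∧ e j y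

shift : ℕ → Matrix → Matrix
shift c e i x = e (c + i) (c + x)

-- The entries lost with the first c rows and columns: those in the first c rows, then those in the
-- first c columns further down, as far as the known prefix shows them.
corner : ℕ → ℕ → ℕ → Matrix → ℕ
corner c k w e =
  ∑ c (λ i → ∑ w λ x → ⟦ e i x ⟧) + ∑ (k ∸ c) λ i → ∑ c λ x → ⟦ e (c + i) x ⟧

<ᵇ-shift : ∀ c m n → (c + m <ᵇ c + n) ≡ (m <ᵇ n)
<ᵇ-shift zero    m n = refl
<ᵇ-shift (suc c) m n = <ᵇ-shift c m n

-- Translation keeps the crossing relation, and the entries cut off could only contribute further
-- crossings.
shift-planar : ∀ c {p q e} → Planar (c + p) (c + q) e → Planar p q (shift c e)
shift-planar c {p} {q} {e} D = record
  { inside = λ t → case inside D t of λ (i<p , x<q) →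
      +-cancelˡ-< c _ _ i<p , +-cancelˡ-< c _ _ x<q
  ; sparse = λ {i} {x} t → ≤-trans (crossed-shift i x) (sparse D t)
  }
  where
  open ≤-Reasoning
  crossed-shift : ∀ i x → crossed p q (shift c e) i x ≤ crossed (c + p) (c + q) e (c + i) (c + x)
  crossed-shift i x = begin
    (∑ p λ j → ∑ q λ y → ⟦ cross i x j y ∧ e (c + j) (c + y) ⟧)
      ≤⟨ (∑-mono p λ j _ → ∑-mono q λ y _ → ≤-reflexive (cong (λ b → ⟦ b ∧ e (c + j) (c + y) ⟧)
          (cong₂ _∨_ (cong₂ _∧_ (sym (<ᵇ-shift c i j)) (sym (<ᵇ-shift c y x)))
                     (cong₂ _∧_ (sym (<ᵇ-shift c j i)) (sym (<ᵇ-shift c x y)))))) ⟩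
    (∑ p λ j → ∑ q λ y → F (c + j) (c + y))
      ≤⟨ ∑-mono p (λ j _ → ∑-tail q (F (c + j))) ⟩
    (∑ p λ j → ∑ (c + q) (F (c + j)))
      ≤⟨ ∑-tail p (λ j → ∑ (c + q) (F j)) ⟩
    (∑ (c + p) λ j → ∑ (c + q) (F j)) ∎
    where
    F : ℕ → ℕ → ℕ
    F j y = ⟦ cross (c + i) (c + x) j y ∧ e j y ⟧
    ∑-tail : ∀ n f → ∑ n (f ∘ (c +_)) ≤ ∑ (c + n) f
    ∑-tail n f = ≤-trans (m≤n+m _ _) (≤-reflexive (sym (∑-split c n f)))

<pred⇒suc< : ∀ {m n} → m < pred n → suc m < n
<pred⇒suc< {n = suc _} = s<s

overcrossed : ℕ → ℕ → Matrix → Bool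
overcrossed k w l =
  anyᵇ k λ i → anyᵇ w λ x → l i x ∧ (5 <ᵇ crossed k w l i x + missing k l x)

short : ℕ → ℕ → Matrix → Bool
short k w l = anyᵇ (pred k) λ i → rowShare w l i <ᵇ 3

-- More than five entries north-east of a position rule out an entry there, so
-- the first c columns are already complete.  Since 𝒮 violates the integral
-- bound 4 m + 18 ≤ 9 n by 2, the removed corner has 2 to spare or what remains
-- is visibly different from 𝒮.
detachable : ℕ → ℕ → ℕ → Matrix → Bool
detachable c k w l =
  (c ≤ᵇ k) ∧ (c ≤ᵇ w) ∧ (3 ≤ᵇ (k ∸ c) + (w ∸ c)) ∧
  not (anyᵇ c λ x → northEast k w l x ≤ᵇ 5) ∧
  ((4 * corner c k w l + 2 ≤ᵇ 9 * (c + c)) ∨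
   ((4 * corner c k w l ≤ᵇ 9 * (c + c)) ∧ differs (4 ⊓ (k ∸ c)) 4 (shift c l) 𝒮-matrix))

-- The case that the matrix ends after k rows. In order: excluded by `2≤p`, within the bound,
-- excluded by `colShare≥3`, or equal to 𝒮.
complete : ℕ → ℕ → Matrix → Bool
complete k w l =
  (k <ᵇ 2) ∨
  (4 * count k w l + 18 ≤ᵇ 9 * (k + w)) ∨
  (anyᵇ (pred w) λ x → colShare k l x <ᵇ 3) ∨
  ((k ≡ᵇ 4) ∧ (w ≡ᵇ 4) ∧ not (differs 4 4 l 𝒮-matrix))

extend : ℕ → List Bool → Matrix → Matrix
extend k r l i x = if i <ᵇ k then l i x else r ! x

-- The first k rows are those of l and have width w; the first argument bounds
-- the number of rows to be guessed.
search : ℕ → ℕ → ℕ → Matrix → Bool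
search zero    k w l = false
search (suc n) k w l =
  short k w l ∨ overcrossed k w l ∨ anyᵇ 4 (λ c → detachable (suc c) k w l) ∨
  (complete k w l ∧
   all (λ r → search n (suc k) (w ⊔ length r) (extend k r l)) (rows (w + 3)))

-- Soundness of the search

𝒮-count : ∀ {p q e} → Is𝒮 p q e → count p q e ≡ 14
𝒮-count s with refl ← p≡4 s | refl ← q≡4 s = count-cong 4 4 λ _ _ → agree s

-- The situation in which no merge is available: consecutive rows and columns share at least three
-- entries, and `smaller` is the induction hypothesis.
module Exploration {p q : ℕ} {e : Matrix} (D : Planar p q e) (2≤p : 2 ≤ p)
  (rowShare≥3 : ∀ i → suc i < p → 3 ≤ rowShare q e i)
  (colShare≥3 : ∀ x → suc x < q → 3 ≤ colShare p e x)
  (smaller : ∀ {p′ q′ : ℕ} {e′ : Matrix} → p′ + q′ < p + q → 3 ≤ p′ + q′ →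
             Planar p′ q′ e′ → Good p′ q′ e′)
  where

  open ≤-Reasoning

  -- The invariant tying the guessed rows `l` to the actual matrix. The width w concerns only the
  -- first k rows; later ones may reach further.
  record Prefix (k w : ℕ) (l : Matrix) : Set where
    field
      k≤p    : k ≤ p
      w≤q    : w ≤ q
      agrees : ∀ {i} → i < k → ∀ x → e i x ≡ l i x
      within : ∀ {i x} → i < k → T (e i x) → x < w

  open Prefix

  colShare≡ : ∀ {k w l} → Prefix k w l → ∀ x → colShare k e x ≡ colShare k l x
  colShare≡ {k} P x = ∑-cong k λ i i<k →
    cong₂ (λ a b → ⟦ a ∧ b ⟧) (agrees P i<k x) (agrees P i<k (suc x))

  rest : ℕ → ℕ → ℕ
  rest k x = ∑ (p ∸ k) λ j → ∑ x λ y → ⟦ e (k + j) y ⟧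

  -- Columns y and y + 1 share three rows. Those not among the first k lie below, and each of them
  -- has an entry in column y.
  missing≤rest : ∀ {k x} → k ≤ p → x < q → missing k e x ≤ rest k x
  missing≤rest {k} {x} k≤p x<q = begin
    missing k e x                                  ≤⟨ ∑-mono x column ⟩
    (∑ x λ y → ∑ (p ∸ k) λ j → ⟦ e (k + j) y ⟧) ≡⟨ ∑-swap x (p ∸ k) _ ⟩
    rest k x                                       ∎
    where
    column : ∀ y → y < x → 3 ∸ colShare k e y ≤ ∑ (p ∸ k) λ j → ⟦ e (k + j) y ⟧
    column y y<x = m≤n+o⇒m∸n≤o 3 (colShare k e y) (begin
      3                    ≤⟨ colShare≥3 y (≤-trans (s<s y<x) x<q) ⟩
      colShare p e y       ≡⟨ cong (λ z → colShare z e y) (m+[n∸m]≡n k≤p) ⟨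
      colShare (k + (p ∸ k)) e y
        ≡⟨ ∑-split k (p ∸ k) _ ⟩
      colShare k e y + (∑ (p ∸ k) λ j → ⟦ e (k + j) y ∧ e (k + j) (suc y) ⟧)
        ≤⟨ +-monoʳ-≤ (colShare k e y) (∑-mono (p ∸ k) λ j _ → ⟦⟧-mono (proj₁ ∘ ∧⁻)) ⟩
      colShare k e y + (∑ (p ∸ k) λ j → ⟦ e (k + j) y ⟧) ∎)

  -- Every entry below the first k rows and left of column x is south-west of (i , x), hence crosses
  -- it, in addition to the crossings within the first k rows.
  crossed+rest≤5 : ∀ {k w i x} → k ≤ p → w ≤ q → i < k → T (e i x) →
                   crossed k w e i x + rest k x ≤ 5
  crossed+rest≤5 {k} {w} {i} {x} k≤p w≤q i<k t = begin
    crossed k w e i x + rest k x ≤⟨ +-mono-≤ (∑-mono k λ j _ → ∑-range _ w≤q) lower ⟩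
    ∑ k G + ∑ (p ∸ k) (G ∘ (k +_)) ≡⟨ ∑-split k (p ∸ k) G ⟨
    ∑ (k + (p ∸ k)) G            ≡⟨ cong (λ z → ∑ z G) (m+[n∸m]≡n k≤p) ⟩
    crossed p q e i x            ≤⟨ sparse D t ⟩
    5                            ∎
    where
    G : ℕ → ℕ
    G j = ∑ q λ y → ⟦ cross i x j y ∧ e j y ⟧
    lower : rest k x ≤ ∑ (p ∸ k) (G ∘ (k +_))
    lower = ∑-mono (p ∸ k) λ j _ → ≤-trans
      (∑-mono x λ y y<x → ⟦⟧-mono (∧⁺ (cross-sw i x (k + j) y (≤-trans i<k (m≤m+n k j)) y<x)))
      (∑-range _ (<⇒≤ (proj₂ (inside D t))))

  crossed+missing≤5 : ∀ {k w l} → Prefix k w l → ∀ {i x} → i < k → T (e i x) →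
                      crossed k w l i x + missing k l x ≤ 5
  crossed+missing≤5 {k} {w} {l} P {i} {x} i<k t = begin
    crossed k w l i x + missing k l x
      ≡⟨ cong₂ _+_ (crossed-cong k w (λ j y j<k _ → agrees P j<k y) i x)
                   (∑-cong x λ y _ → cong (3 ∸_) (colShare≡ P y)) ⟨
    crossed k w e i x + missing k e x
      ≤⟨ +-monoʳ-≤ _ (missing≤rest (k≤p P) (proj₂ (inside D t))) ⟩
    crossed k w e i x + rest k x
      ≤⟨ crossed+rest≤5 (k≤p P) (w≤q P) i<k t ⟩
    5 ∎

  -- Three columns without earlier entries would each need two entries below row k.
  next-row : ∀ {k w l} → Prefix k w l → k < p → ∀ x → T (e k x) → x < w + 3
  next-row {k} {w} P k<p x t with x <? w + 3
  ... | yes x<w+3 = x<w+3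
  ... | no  x≮w+3 = contradiction 6≤5 (n≮n 5)
    where
    fresh : ∀ y → 3 ∸ colShare (suc k) e (w + y) ≥ 2
    fresh y = ∸-monoʳ-≤ 3 (begin
      colShare (suc k) e (w + y)
        ≡⟨ ∑-last k _ ⟩
      colShare k e (w + y) + ⟦ e k (w + y) ∧ e k (suc (w + y)) ⟧
        ≤⟨ +-mono-≤ (≤-reflexive (∑-zero k λ i i<k → ⟦⟧≡0 λ t′ →
             m+n≮m w y (within P i<k (proj₁ (∧⁻ t′))))) (⟦⟧≤1 (e k (w + y) ∧ _)) ⟩
      1 ∎)
    6≤5 : 6 ≤ 5
    6≤5 = begin
      6                                                  ≤⟨ ∑-mono 3 (λ y _ → fresh y) ⟩
      (∑ 3 λ y → 3 ∸ colShare (suc k) e (w + y))        ≤⟨ m≤n+m _ (missing (suc k) e w) ⟩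
      missing (suc k) e w + (∑ 3 λ y → 3 ∸ colShare (suc k) e (w + y)) ≡⟨ ∑-split w 3 _ ⟨
      missing (suc k) e (w + 3)                          ≤⟨ ∑-range _ (≮⇒≥ x≮w+3) ⟩
      missing (suc k) e x ≤⟨ missing≤rest k<p (proj₂ (inside D t)) ⟩
      rest (suc k) x      ≤⟨ m≤n+m _ _ ⟩
      crossed (suc k) 0 e k x + rest (suc k) x ≤⟨ crossed+rest≤5 k<p z≤n ≤-refl t ⟩
      5                   ∎

  -- An entry at (j , x) in a later row would be crossed by everything that `northEast` counts,
  -- which is more than `sparse` permits.
  closed : ∀ {k w l} → Prefix k w l → ∀ {j x} → 5 < northEast k w l x → k ≤ j → ¬ T (e j x)
  closed {k} {w} {l} P {j} {x} 5<ne k≤j t = <⇒≱ 5<ne (begin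
    northEast k w l x
      ≤⟨ count-mono k w (λ {i} {y} i<k _ t′ → case ∧⁻ {x <ᵇ y} t′ of λ (x<y , lt) →
           ∧⁺ (cross-ne j x i y (≤-trans i<k k≤j) (<ᵇ⇒< x y x<y))
              (subst T (sym (agrees P i<k y)) lt)) ⟩
    crossed k w e j x
      ≤⟨ ∑-mono k (λ i _ → ∑-range _ (w≤q P)) ⟩
    crossed k q e j x
      ≤⟨ ∑-range _ (k≤p P) ⟩
    crossed p q e j x
      ≤⟨ sparse D t ⟩
    5 ∎)

  module _ {k w : ℕ} {l : Matrix} (P : Prefix k w l) (c : ℕ) (c≤k : c ≤ k) (c≤w : c ≤ w)
           (closed< : ∀ {x : ℕ} → x < c → 5 < northEast k w l x) where

    -- The first c rows stop before column w by `within`, and the first c columns stop before row k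
    -- by `closed`; so everything removed is visible in the prefix.
    detach : count p q e ≡ corner c k w l + count (p ∸ c) (q ∸ c) (shift c e)
    detach = begin-equality
      count p q e
        ≡⟨ cong₂ (λ a b → count a b e) (m+[n∸m]≡n c≤p) (m+[n∸m]≡n c≤q) ⟨
      count (c + p′) (c + q′) e
        ≡⟨ ∑-split c p′ _ ⟩
      (∑ c λ i → ∑ (c + q′) λ x → ⟦ e i x ⟧) + (∑ p′ λ i → ∑ (c + q′) λ x → ⟦ e (c + i) x ⟧)
        ≡⟨ cong₂ _+_ top (trans (∑-cong p′ λ i _ → ∑-split c q′ _) (∑-+ p′ _ _)) ⟩
      (∑ c λ i → ∑ w λ x → ⟦ l i x ⟧) +
        ((∑ p′ λ i → ∑ c λ x → ⟦ e (c + i) x ⟧) + count p′ q′ (shift c e))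
        ≡⟨ cong (λ z → (∑ c λ i → ∑ w λ x → ⟦ l i x ⟧) + (z + count p′ q′ (shift c e))) left ⟩
      (∑ c λ i → ∑ w λ x → ⟦ l i x ⟧) +
        ((∑ (k ∸ c) λ i → ∑ c λ x → ⟦ l (c + i) x ⟧) + count p′ q′ (shift c e))
        ≡⟨ +-assoc (∑ c λ i → ∑ w λ x → ⟦ l i x ⟧) _ _ ⟨
      corner c k w l + count p′ q′ (shift c e) ∎
      where
      p′ = p ∸ c
      q′ = q ∸ c
      c≤p = ≤-trans c≤k (k≤p P)
      c≤q = ≤-trans c≤w (w≤q P)
      top : (∑ c λ i → ∑ (c + q′) λ x → ⟦ e i x ⟧) ≡ (∑ c λ i → ∑ w λ x → ⟦ l i x ⟧)
      top = ∑-cong c λ i i<c → let i<k = ≤-trans i<c c≤k in trans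
        (∑-support _ (≤-trans (w≤q P) (≤-reflexive (sym (m+[n∸m]≡n c≤q))))
           (λ x w≤x → ⟦⟧≡0 λ t → ≤⇒≯ w≤x (within P i<k t)))
        (∑-cong w λ x _ → cong ⟦_⟧ (agrees P i<k x))
      left : (∑ p′ λ i → ∑ c λ x → ⟦ e (c + i) x ⟧) ≡ (∑ (k ∸ c) λ i → ∑ c λ x → ⟦ l (c + i) x ⟧)
      left = trans
        (∑-support _ (∸-monoˡ-≤ c (k≤p P)) λ i k∸c≤i → ∑-zero c λ x x<c → ⟦⟧≡0
           (closed P (closed< x<c) (≤-trans (≤-reflexive (sym (m+[n∸m]≡n c≤k))) (+-monoʳ-≤ c k∸c≤i))))
        (∑-cong (k ∸ c) λ i i<k∸c → ∑-cong c λ x _ → cong ⟦_⟧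
           (agrees P (≤-trans (+-monoʳ-< c i<k∸c) (≤-reflexive (m+[n∸m]≡n c≤k))) x))

  overcrossed-⊥ : ∀ {k w l} → Prefix k w l → ¬ T (overcrossed k w l)
  overcrossed-⊥ {k} {w} {l} P t
    with i , i<k , t ← anyᵇ⁻ k t
    with x , _ , t ← anyᵇ⁻ w t
    with lix , 5<c ← ∧⁻ {l i x} t =
    <⇒≱ (<ᵇ⇒< 5 _ 5<c) (crossed+missing≤5 P i<k (subst T (sym (agrees P i<k x)) lix))

  short-⊥ : ∀ {k w l} → Prefix k w l → ¬ T (short k w l)
  short-⊥ {suc k} {w} {l} P t with i , i<k , t ← anyᵇ⁻ k t =
    <⇒≱ (<ᵇ⇒< _ 3 t) (begin
      3              ≤⟨ rowShare≥3 i (≤-trans (s<s i<k) (k≤p P)) ⟩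
      rowShare q e i ≡⟨ ∑-support _ (w≤q P) (λ x w≤x → ⟦⟧≡0 λ t′ →
                          ≤⇒≯ w≤x (within P (m<n⇒m<1+n i<k) (proj₁ (∧⁻ t′)))) ⟩
      rowShare w e i ≡⟨ ∑-cong w (λ x _ → cong₂ (λ a b → ⟦ a ∧ b ⟧)
                          (agrees P (m<n⇒m<1+n i<k) x) (agrees P (s<s i<k) x)) ⟩
      rowShare w l i ∎)

  count-prefix : ∀ {w l} → Prefix p w l → count p q e ≡ count p w l
  count-prefix {w} P = ∑-cong p λ i i<p → trans
    (∑-support _ (w≤q P) λ x w≤x → ⟦⟧≡0 λ t → ≤⇒≯ w≤x (within P i<p t))
    (∑-cong w λ x _ → cong ⟦_⟧ (agrees P i<p x))

  complete-good : ∀ {w l} → Prefix p w l → T (complete p w l) → Good p q e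
  complete-good {w} {l} P t with ∨⁻ {p <ᵇ 2} t
  ... | inj₁ p<2 = contradiction (<ᵇ⇒< p 2 p<2) (≤⇒≯ 2≤p)
  ... | inj₂ t with ∨⁻ {4 * count p w l + 18 ≤ᵇ 9 * (p + w)} t
  ... | inj₁ bound = inj₁ (begin
    4 * count p q e + 18 ≡⟨ cong (λ m → 4 * m + 18) (count-prefix P) ⟩
    4 * count p w l + 18 ≤⟨ ≤ᵇ⇒≤ (4 * count p w l + 18) _ bound ⟩
    -- Columns beyond w are empty here and only raise the right-hand side.
    9 * (p + w)          ≤⟨ *-monoʳ-≤ 9 (+-monoʳ-≤ p (w≤q P)) ⟩
    9 * (p + q)          ∎)
  ... | inj₂ t with ∨⁻ {anyᵇ (pred w) λ x → colShare p l x <ᵇ 3} t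
  ... | inj₁ t with x , x<w , t ← anyᵇ⁻ (pred w) t =
    contradiction (colShare≥3 x (≤-trans (<pred⇒suc< x<w) (w≤q P)))
                  (<⇒≱ (≤-trans (≤-reflexive (cong suc (colShare≡ P x))) (<ᵇ⇒< _ 3 t)))
  ... | inj₂ t with p≡4 , t ← ∧⁻ {p ≡ᵇ 4} t with w≡4 , t ← ∧⁻ {w ≡ᵇ 4} t =
    𝒮-or-bound (≡ᵇ⇒≡ p 4 p≡4) (≡ᵇ⇒≡ w 4 w≡4) (differs-≡ 4 4 l 𝒮-matrix (not⁻ t))
    where
    𝒮-or-bound : p ≡ 4 → w ≡ 4 → (∀ {i x} → i < 4 → x < 4 → l i x ≡ 𝒮-matrix i x) → Good p q e
    𝒮-or-bound refl refl l≡𝒮 with q ≟ 4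
    ... | yes q≡4 = inj₂ record
      { p≡4 = refl ; q≡4 = q≡4 ; agree = λ {_} {x} i<4 x<4 → trans (agrees P i<4 x) (l≡𝒮 i<4 x<4) }
    -- With further empty columns there are at least nine vertices, and 4 * 14 + 18 = 74 ≤ 81.
    ... | no  q≢4 = inj₁ (begin
      4 * count 4 q e + 18 ≡⟨ cong (λ m → 4 * m + 18) (trans (count-prefix P)
                                (count-cong 4 4 λ _ _ → l≡𝒮)) ⟩
      74                   ≤⟨ m≤m+n 74 7 ⟩
      9 * (4 + 5)          ≤⟨ *-monoʳ-≤ 9 (+-monoʳ-≤ 4 (≤∧≢⇒< (w≤q P) (q≢4 ∘ sym))) ⟩
      9 * (4 + q)          ∎)

  -- The bound for the remainder already pays for the constant 18, so the removed entries need only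
  -- be covered by 9 for each of the 2c removed vertices.
  detachable-good : ∀ {k w l} → Prefix k w l → ∀ c → T (detachable (suc c) k w l) → Good p q e
  detachable-good {k} {w} {l} P c′ t
    with c≤k , t ← ∧⁻ {c′ <ᵇ k} t
    with c≤w , t ← ∧⁻ {c′ <ᵇ w} t
    with 3≤ , t ← ∧⁻ {3 ≤ᵇ (k ∸ suc c′) + (w ∸ suc c′)} t
    with cl , t ← ∧⁻ {not (anyᵇ (suc c′) λ x → northEast k w l x ≤ᵇ 5)} t =
    inj₁ (begin
      4 * count p q e + 18         ≡⟨ cong (λ m → 4 * m + 18) (detach P c c≤k′ c≤w′ closed<) ⟩
      4 * (corner c k w l + M) + 18 ≤⟨ bound (∨⁻ t) rest-good ⟩
      9 * ((c + c) + (p′ + q′))    ≡⟨ cong (9 *_) sizes ⟩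
      9 * (p + q)                  ∎)
    where
    c  = suc c′
    p′ = p ∸ c
    q′ = q ∸ c
    M  = count p′ q′ (shift c e)
    c≤k′ : c ≤ k
    c≤k′ = <ᵇ⇒< c′ k c≤k
    c≤w′ : c ≤ w
    c≤w′ = <ᵇ⇒< c′ w c≤w
    c+p′ : c + p′ ≡ p
    c+p′ = m+[n∸m]≡n (≤-trans c≤k′ (k≤p P))
    c+q′ : c + q′ ≡ q
    c+q′ = m+[n∸m]≡n (≤-trans c≤w′ (w≤q P))
    sizes : (c + c) + (p′ + q′) ≡ p + q
    sizes = trans (interchange c c p′ q′) (cong₂ _+_ c+p′ c+q′)
    closed< : ∀ {x} → x < c → 5 < northEast k w l x
    closed< {x} x<c = ≰⇒> λ ne≤5 → not⁻ cl (anyᵇ⁺ {P = λ x → northEast k w l x ≤ᵇ 5} x<c (≤⇒≤ᵇ ne≤5))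
    rest-good : Good p′ q′ (shift c e)
    rest-good = smaller
      (≤-trans (m<n+m (p′ + q′) {c + c} z<s) (≤-reflexive sizes))
      (≤-trans (≤ᵇ⇒≤ 3 _ 3≤) (+-mono-≤ (∸-monoˡ-≤ c (k≤p P)) (∸-monoˡ-≤ c (w≤q P))))
      (shift-planar c (subst₂ (λ a b → Planar a b e) (sym c+p′) (sym c+q′) D))
    bound : T (4 * corner c k w l + 2 ≤ᵇ 9 * (c + c)) ⊎
            T ((4 * corner c k w l ≤ᵇ 9 * (c + c)) ∧
               differs (4 ⊓ (k ∸ c)) 4 (shift c l) 𝒮-matrix) →
            Good p′ q′ (shift c e) →
            4 * (corner c k w l + M) + 18 ≤ 9 * ((c + c) + (p′ + q′))
    -- When the remainder satisfies the bound, `4 * K ≤ 9 * (c + c)` suffices, and both tests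
    -- provide it.
    bound t (inj₁ h) = begin
      4 * (K + M) + 18            ≡⟨ solve 2 (λ a m → con 4 :* (a :+ m) :+ con 18 :=
                                      con 4 :* a :+ (con 4 :* m :+ con 18)) refl K M ⟩
      4 * K + (4 * M + 18)        ≤⟨ +-mono-≤ (tight t) h ⟩
      9 * (c + c) + 9 * (p′ + q′) ≡⟨ *-distribˡ-+ 9 (c + c) (p′ + q′) ⟨
      9 * ((c + c) + (p′ + q′))   ∎
      where
      K = corner c k w l
      tight : _ → 4 * K ≤ 9 * (c + c)
      tight (inj₁ s) = ≤-trans (m≤m+n (4 * K) 2) (≤ᵇ⇒≤ (4 * K + 2) _ s)
      tight (inj₂ s) = ≤ᵇ⇒≤ (4 * K) _ (proj₁ (∧⁻ s))
    -- For 𝒮, 4 * 14 + 18 = 74 exceeds 9 * 8 by the two that the first test keeps in reserve.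
    bound (inj₁ s) (inj₂ is𝒮) = begin
      4 * (K + M) + 18            ≡⟨ cong (λ m → 4 * (K + m) + 18) (𝒮-count is𝒮) ⟩
      4 * (K + 14) + 18           ≡⟨ solve 1 (λ a → con 4 :* (a :+ con 14) :+ con 18 :=
                                      (con 4 :* a :+ con 2) :+ con 72) refl K ⟩
      (4 * K + 2) + 72            ≤⟨ +-monoˡ-≤ 72 (≤ᵇ⇒≤ (4 * K + 2) _ s) ⟩
      9 * (c + c) + 9 * 8         ≡⟨ *-distribˡ-+ 9 (c + c) 8 ⟨
      9 * ((c + c) + 8)           ≡⟨ cong₂ (λ a b → 9 * ((c + c) + (a + b))) (p≡4 is𝒮) (q≡4 is𝒮) ⟨
      9 * ((c + c) + (p′ + q′))   ∎
      where K = corner c k w l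
    -- Only known rows of the remainder are compared, hence `4 ⊓ (k ∸ c)`; the difference found
    -- there shows that it is not 𝒮.
    bound (inj₂ s) (inj₂ is𝒮)
      with i , i< , d ← anyᵇ⁻ (4 ⊓ (k ∸ c)) (proj₂ (∧⁻ {4 * corner c k w l ≤ᵇ 9 * (c + c)} s))
      with x , x<4 , d ← anyᵇ⁻ 4 d =
      contradiction
        (trans (sym (agrees P (≤-trans (+-monoʳ-< c (m<n⊓o⇒m<o 4 (k ∸ c) i<))
                                       (≤-reflexive (m+[n∸m]≡n c≤k′))) (c + x)))
               (agree is𝒮 (m<n⊓o⇒m<n 4 (k ∸ c) i<) x<4))
        (xor-≢ {l (c + i) (c + x)} d)

  -- By `next-row` all of row k lies before column w + 3, so trimming it there loses nothing.
  extend-prefix : ∀ {k w l} → Prefix k w l → k < p →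
                  let r = trim (w + 3) (e k) in Prefix (suc k) (w ⊔ length r) (extend k r l)
  extend-prefix {k} {w} {l} P k<p = record
    { k≤p    = k<p
    ; w≤q    = ⊔-lub (w≤q P) (trim-length (w + 3) (e k) λ _ → proj₂ ∘ inside D)
    ; agrees = agrees′
    ; within = within′
    }
    where
    r = trim (w + 3) (e k)
    r≡ : ∀ x → r ! x ≡ e k x
    r≡ = trim-! (w + 3) (e k) (next-row P k<p)
    agrees′ : ∀ {i} → i < suc k → ∀ x → e i x ≡ extend k r l i x
    agrees′ {i} i≤k x with i <ᵇ k in eq
    ... | true  = agrees P (<ᵇ⇒< i k (subst T (sym eq) tt)) x
    ... | false with refl ← ≤∧≮⇒≡ (s≤s⁻¹ i≤k) (λ i<k → subst T eq (<⇒<ᵇ i<k)) = sym (r≡ x)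
    within′ : ∀ {i x} → i < suc k → T (e i x) → x < w ⊔ length r
    within′ {i} {x} i≤k t with i <? k
    ... | yes i<k = m<n⇒m<n⊔o (length r) (within P i<k t)
    ... | no  i≮k with refl ← ≤∧≮⇒≡ (s≤s⁻¹ i≤k) i≮k =
      m<n⇒m<o⊔n w (!-length r (subst T (sym (r≡ x)) t))

  -- Past the immediate exits, either the matrix ends at k rows and `complete` applies, or its next
  -- row is one of those tried.
  search-good : ∀ n {k w l} → Prefix k w l → T (search n k w l) → Good p q e
  search-good (suc n) {k} {w} {l} P t with ∨⁻ {short k w l} t
  ... | inj₁ t = ⊥-elim (short-⊥ P t)
  ... | inj₂ t with ∨⁻ {overcrossed k w l} t
  ... | inj₁ t = ⊥-elim (overcrossed-⊥ P t)
  ... | inj₂ t with ∨⁻ {anyᵇ 4 λ c → detachable (suc c) k w l} t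
  ... | inj₁ t with c , _ , t ← anyᵇ⁻ 4 t = detachable-good P c t
  ... | inj₂ t with done , more ← ∧⁻ {complete k w l} t with k ≟ p
  ... | yes refl = complete-good P done
  ... | no  k≢p  = search-good n (extend-prefix P k<p)
    (all⁻ (λ r → search n (suc k) (w ⊔ length r) (extend k r l)) more (trim-∈ (w + 3) (e k)))
    where k<p = ≤∧≢⇒< (k≤p P) k≢p

  search-true : ∀ n {k w l} → Prefix k w l → search n k w l ≡ true → Good p q e
  search-true n P eq = search-good n P (subst T (sym eq) tt)

-- Merging two consecutive rows

merge : ℕ → Matrix → Matrix
merge zero    e zero    x = e 0 x ∨ e 1 x
merge zero    e (suc i) x = e (suc (suc i)) x
merge (suc a) e zero    x = e 0 x
merge (suc a) e (suc i) x = merge a (e ∘ suc) i x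

collapse : ℕ → ℕ → ℕ
collapse a       zero    = 0
collapse zero    (suc i) = i
collapse (suc a) (suc i) = suc (collapse a i)

collapse-mono : ∀ a {i j} → i ≤ j → collapse a i ≤ collapse a j
collapse-mono a       z≤n       = z≤n
collapse-mono zero    (s≤s i≤j) = i≤j
collapse-mono (suc a) (s≤s i≤j) = s≤s (collapse-mono a i≤j)

-- Strict order of rows is reflected though not preserved, which is why merging may destroy
-- crossings but creates none.
collapse-cancel-< : ∀ a {i j} → collapse a i < collapse a j → i < j
collapse-cancel-< a {i} {j} h = ≰⇒> λ j≤i → <⇒≱ h (collapse-mono a j≤i)

collapse-< : ∀ {a i n} → a < n → i < suc n → collapse a i < n
collapse-< {_}     {zero}  a<n       _         = ≤-trans (s≤s z≤n) a<n
collapse-< {zero}  {suc i} _         (s≤s i<n) = i<n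
collapse-< {suc a} {suc i} (s≤s a<n) (s≤s i<n) = s≤s (collapse-< a<n i<n)

merge-lift : ∀ a e i {x} → T (merge a e i x) → ∃[ j ] collapse a j ≡ i × T (e j x)
merge-lift zero    e zero    t with ∨⁻ t
... | inj₁ t₀ = 0 , refl , t₀
... | inj₂ t₁ = 1 , refl , t₁
merge-lift zero    e (suc i) t = suc (suc i) , refl , t
merge-lift (suc a) e zero    t = 0 , refl , t
merge-lift (suc a) e (suc i) t with j , eq , t′ ← merge-lift a (e ∘ suc) i t =
  suc j , cong suc eq , t′

∧-mapˡ : ∀ {a b c} → (T a → T b) → T (a ∧ c) → T (b ∧ c)
∧-mapˡ {a} f t with s , s′ ← ∧⁻ {a} t = ∧⁺ (f s) s′

∧∨-split : ∀ {p u v} a b → (T p → T u) → (T p → T v) →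
           ⟦ p ∧ (a ∨ b) ⟧ ≤ ⟦ u ∧ a ⟧ + ⟦ v ∧ b ⟧
∧∨-split {false}                a b f g = z≤n
∧∨-split {true} {true}  {true}  a b f g =
  ≤-trans (m≤m+n _ _) (≤-reflexive (sym (⟦∨⟧+⟦∧⟧ a b)))
∧∨-split {true} {false} {_}     a b f g = ⊥-elim (f tt)
∧∨-split {true} {true}  {false} a b f g = ⊥-elim (g tt)

-- Distinct merged entries come from distinct original ones. In use, P and Q say that a fixed edge
-- is crossed after and before the merge.
merge-count : ∀ n q a e (P Q : Matrix) → (∀ i x → T (P (collapse a i) x) → T (Q i x)) →
              count n q (λ i x → P i x ∧ merge a e i x) ≤ count (suc n) q (λ i x → Q i x ∧ e i x)
merge-count zero    q a       e P Q P⇒Q = z≤n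
merge-count (suc n) q zero    e P Q P⇒Q = begin
  (∑ q λ x → ⟦ P 0 x ∧ (e 0 x ∨ e 1 x) ⟧) + tail P
    ≤⟨ +-mono-≤ (∑-mono q λ x _ → ∧∨-split (e 0 x) (e 1 x) (P⇒Q 0 x) (P⇒Q 1 x))
                (∑-mono n λ i _ → ∑-mono q λ x _ → ⟦⟧-mono (∧-mapˡ (P⇒Q (suc (suc i)) x))) ⟩
  (∑ q λ x → ⟦ Q 0 x ∧ e 0 x ⟧ + ⟦ Q 1 x ∧ e 1 x ⟧) + tail (Q ∘ suc)
    ≡⟨ cong (_+ tail (Q ∘ suc)) (∑-+ q _ _) ⟩
  (∑ q (λ x → ⟦ Q 0 x ∧ e 0 x ⟧) + ∑ q (λ x → ⟦ Q 1 x ∧ e 1 x ⟧)) + tail (Q ∘ suc)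
    ≡⟨ +-assoc (∑ q λ x → ⟦ Q 0 x ∧ e 0 x ⟧) _ _ ⟩
  count (suc (suc n)) q (λ i x → Q i x ∧ e i x) ∎
  where
  open ≤-Reasoning
  tail : Matrix → ℕ
  tail R = ∑ n λ i → ∑ q λ x → ⟦ R (suc i) x ∧ e (suc (suc i)) x ⟧
merge-count (suc n) q (suc a) e P Q P⇒Q = +-mono-≤
  (∑-mono q λ x _ → ⟦⟧-mono (∧-mapˡ (P⇒Q 0 x)))
  (merge-count n q a (e ∘ suc) (P ∘ suc) (Q ∘ suc) λ i x → P⇒Q (suc i) x)

-- Column by column this is `⟦∨⟧+⟦∧⟧`: what the union of the two rows loses is their common part.
merge-loss : ∀ n q a e → a < n → count (suc n) q e ≡ count n q (merge a e) + rowShare q e a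
merge-loss (suc n) q zero e _ = begin
  r 0 + (r 1 + tail)                   ≡⟨ +-assoc (r 0) (r 1) tail ⟨
  r 0 + r 1 + tail                     ≡⟨ cong (_+ tail) (∑-+ q _ _) ⟨
  (∑ q λ x → ⟦ e 0 x ⟧ + ⟦ e 1 x ⟧) + tail
    ≡⟨ cong (_+ tail) (trans (∑-cong q λ x _ → ⟦∨⟧+⟦∧⟧ (e 0 x) (e 1 x)) (∑-+ q _ _)) ⟩
  both + rowShare q e 0 + tail         ≡⟨ +-assoc both _ tail ⟩
  both + (rowShare q e 0 + tail)       ≡⟨ cong (both +_) (+-comm (rowShare q e 0) tail) ⟩
  both + (tail + rowShare q e 0)       ≡⟨ +-assoc both tail _ ⟨
  both + tail + rowShare q e 0         ∎
  where
  open ≡-Reasoning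
  r : ℕ → ℕ
  r i = ∑ q λ x → ⟦ e i x ⟧
  tail = ∑ n λ i → r (suc (suc i))
  both = ∑ q λ x → ⟦ e 0 x ∨ e 1 x ⟧
merge-loss (suc n) q (suc a) e (s≤s a<n) =
  trans (cong ((∑ q λ x → ⟦ e 0 x ⟧) +_) (merge-loss n q a (e ∘ suc) a<n))
        (sym (+-assoc (∑ q λ x → ⟦ e 0 x ⟧) _ _))

-- An entry lifts to an original one, and by `merge-count` that one is crossed at least as often.
merge-planar : ∀ {p q a e} → a < p → Planar (suc p) q e → Planar p q (merge a e)
merge-planar {p} {q} {a} {e} a<p D = record { inside = inside′ _ ; sparse = sparse′ _ }
  where
  inside′ : ∀ i {x} → T (merge a e i x) → i < p × x < q
  inside′ i t with j , refl , t′ ← merge-lift a e i t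
              with j<p , x<q ← inside D t′ = collapse-< a<p j<p , x<q
  sparse′ : ∀ i {x} → T (merge a e i x) → crossed p q (merge a e) i x ≤ 5
  sparse′ i {x} t with j , refl , t′ ← merge-lift a e i t =
    ≤-trans (merge-count p q a e (cross (collapse a j) x) (cross j x) λ k y →
               cross-⇒ (collapse a j) x (collapse a k) y j x k y
                 (collapse-cancel-< a) (λ y<x → y<x) (collapse-cancel-< a) (λ x<y → x<y))
            (sparse D t′)

-- Splitting a row of 𝒮

unmerge : ℕ → (ℕ → Bool) → (ℕ → Bool) → Matrix → Matrix
unmerge zero    r s f zero          = r
unmerge zero    r s f (suc zero)    = s
unmerge zero    r s f (suc (suc i)) = f (suc i)
unmerge (suc a) r s f zero          = f 0
unmerge (suc a) r s f (suc i)       = unmerge a r s (f ∘ suc) i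

-- A matrix is determined by its merge and the two rows merged, so the splittings of 𝒮 are
-- parametrised by pairs of rows.
unmerge-merge : ∀ n a {q e f} → a < n → (∀ {i x} → i < n → x < q → merge a e i x ≡ f i x) →
                ∀ {r s} → (∀ x → r x ≡ e a x) → (∀ x → s x ≡ e (suc a) x) →
                ∀ i x → i < suc n → x < q → e i x ≡ unmerge a r s f i x
unmerge-merge n zero a<n m≡f r≡ s≡ zero x i<n x<q = sym (r≡ x)
unmerge-merge n zero a<n m≡f r≡ s≡ (suc zero) x i<n x<q = sym (s≡ x)
unmerge-merge n zero a<n m≡f r≡ s≡ (suc (suc i)) x i<n x<q = m≡f (s≤s⁻¹ i<n) x<q
unmerge-merge (suc n) (suc a) a<n m≡f r≡ s≡ zero x i<n x<q = m≡f z<s x<q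
unmerge-merge (suc n) (suc a) a<n m≡f r≡ s≡ (suc i) x i<n x<q =
  unmerge-merge n a (s≤s⁻¹ a<n) (λ i<n x<q → m≡f (s≤s i<n) x<q) r≡ s≡ i x (s≤s⁻¹ i<n) x<q

merge-at : ∀ a e x → merge a e a x ≡ e a x ∨ e (suc a) x
merge-at zero    e x = refl
merge-at (suc a) e x = merge-at a (e ∘ suc) x

no-split : ℕ → List Bool → List Bool → Bool
no-split a r s =
  anyᵇ 4 (λ x → (r ! x ∨ s ! x) xor 𝒮-matrix a x) ∨
  (∑ 4 (λ x → ⟦ r ! x ∧ s ! x ⟧) <ᵇ 2) ∨
  anyᵇ 5 (λ i → anyᵇ 4 λ x → l i x ∧ (5 <ᵇ crossed 5 4 l i x))
  where
  l : Matrix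
  l = unmerge a (r !_) (s !_) 𝒮-matrix

-- Four positions and 16 × 16 pairs of rows in four columns, settled by evaluation.
no-splits : Bool
no-splits = all (λ a → all (λ r → all (no-split a r) (rows 4)) (rows 4)) (0 ∷ 1 ∷ 2 ∷ 3 ∷ [])

no-splits-hold : T no-splits
no-splits-hold = tt

-- Sharing two entries would give 16 edges on nine vertices, and 4 * 16 + 18 = 82 > 81; hence the
-- need for an inspection of cases.
unsplittable : ∀ {a e} → a < 4 → Planar 5 4 e → Is𝒮 4 4 (merge a e) → rowShare 4 e a < 2
unsplittable {a} {e} a<4 D s = case ∨⁻ no-split-rs of λ where
    (inj₁ t) → case anyᵇ⁻ 4 t of λ (x , x<4 , t) → ⊥-elim (xor-≢ t
      (trans (cong₂ _∨_ (r≡ x) (s≡ x)) (trans (sym (merge-at a e x)) (agree s a<4 x<4))))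
    (inj₂ t) → case ∨⁻ {∑ 4 (λ x → ⟦ r₁ ! x ∧ r₂ ! x ⟧) <ᵇ 2} t of λ where
      (inj₁ t) → subst (_< 2) (∑-cong 4 λ x _ → cong₂ (λ u v → ⟦ u ∧ v ⟧) (r≡ x) (s≡ x))
                   (<ᵇ⇒< _ 2 t)
      (inj₂ t) → case anyᵇ⁻ 5 t of λ (i , i<5 , t) → case anyᵇ⁻ 4 t of λ (x , x<4 , t) →
        case ∧⁻ {unmerge a (r₁ !_) (r₂ !_) 𝒮-matrix i x} t of λ (lix , 5<c) →
          ⊥-elim (<⇒≱ (<ᵇ⇒< 5 _ 5<c) (≤-trans
            (≤-reflexive (crossed-cong 5 4 (λ j y j<5 y<4 → sym (e≡ j y j<5 y<4)) i x))
            (sparse D (subst T (sym (e≡ i x i<5 x<4)) lix))))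
  where
  r₁ = trim 4 (e a)
  r₂ = trim 4 (e (suc a))
  r≡ : ∀ x → r₁ ! x ≡ e a x
  r≡ = trim-! 4 (e a) λ _ → proj₂ ∘ inside D
  s≡ : ∀ x → r₂ ! x ≡ e (suc a) x
  s≡ = trim-! 4 (e (suc a)) λ _ → proj₂ ∘ inside D
  e≡ : ∀ i x → i < 5 → x < 4 → e i x ≡ unmerge a (r₁ !_) (r₂ !_) 𝒮-matrix i x
  e≡ = unmerge-merge 4 a a<4 (agree s) r≡ s≡
  a∈ : ∀ {a} → a < 4 → a ∈ 0 ∷ 1 ∷ 2 ∷ 3 ∷ []
  a∈ {0} _ = here refl
  a∈ {1} _ = there (here refl)
  a∈ {2} _ = there (there (here refl))
  a∈ {3} _ = there (there (there (here refl)))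
  a∈ {suc (suc (suc (suc _)))} (s≤s (s≤s (s≤s (s≤s ()))))
  no-split-rs : T (no-split a r₁ r₂)
  no-split-rs = all⁻ (no-split a r₁)
    (all⁻ (λ r → all (no-split a r) (rows 4))
      (all⁻ (λ a → all (λ r → all (no-split a r) (rows 4)) (rows 4)) no-splits-hold (a∈ a<4))
      (trim-∈ 4 (e a)))
    (trim-∈ 4 (e (suc a)))

-- Induction on the number of vertices

merge-good : ∀ {p q a e} → a < p → Planar (suc p) q e → rowShare q e a ≤ 2 →
             Good p q (merge a e) → Good (suc p) q e
merge-good {p} {q} {a} {e} a<p D s≤2 (inj₁ h) = inj₁ (begin
  4 * count (suc p) q e + 18 ≡⟨ cong (λ m → 4 * m + 18) (merge-loss p q a e a<p) ⟩
  4 * (M + s) + 18           ≡⟨ solve 2 (λ m s → con 4 :* (m :+ s) :+ con 18 :=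
                                  con 4 :* m :+ con 18 :+ con 4 :* s) refl M s ⟩
  4 * M + 18 + 4 * s         ≤⟨ +-mono-≤ h (*-monoʳ-≤ 4 s≤2) ⟩
  -- The lost entries cost at most 4 * 2 = 8, and the lost vertex is worth 9.
  9 * (p + q) + 8            ≤⟨ +-monoʳ-≤ (9 * (p + q)) (n≤1+n 8) ⟩
  9 * (p + q) + 9            ≡⟨ solve 2 (λ p q → con 9 :* (p :+ q) :+ con 9 :=
                                  con 9 :* (con 1 :+ p :+ q)) refl p q ⟩
  9 * (suc p + q)            ∎)
  where
  open ≤-Reasoning
  M = count p q (merge a e)
  s = rowShare q e a
-- If the merge is 𝒮, at most one entry is shared, so there are at most 15 edges and 4 * 15 + 18 =
-- 78 ≤ 81.
merge-good {a = a} {e} a<p D _ (inj₂ is𝒮) with refl ← p≡4 is𝒮 | refl ← q≡4 is𝒮 = inj₁ (begin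
  4 * count 5 4 e + 18    ≡⟨ cong (λ m → 4 * m + 18) (trans (merge-loss 4 4 a e a<p)
                               (cong (_+ rowShare 4 e a) (𝒮-count is𝒮))) ⟩
  4 * (14 + rowShare 4 e a) + 18
    ≤⟨ +-monoˡ-≤ 18 (*-monoʳ-≤ 4 (+-monoʳ-≤ 14 (s≤s⁻¹ (unsplittable a<p D is𝒮)))) ⟩
  78                      ≤⟨ m≤m+n 78 3 ⟩
  81                      ∎)
  where open ≤-Reasoning

-- A single row has at most q entries, and 4 * q + 18 ≤ 9 * (1 + q) once q ≥ 2.
few-rows : ∀ {p q e} → p ≤ 1 → 3 ≤ p + q → Good p q e
few-rows {zero}  {q}     z≤n       3≤q = inj₁ (≤-trans (m≤m+n 18 9) (*-monoʳ-≤ 9 3≤q))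
few-rows {suc _} {q} {e} (s≤s z≤n) 3≤q = inj₁ (begin
  4 * (∑ q (λ x → ⟦ e 0 x ⟧) + 0) + 18
    ≤⟨ +-monoˡ-≤ 18 (*-monoʳ-≤ 4 (+-monoˡ-≤ 0 (≤-trans (∑-mono q λ x _ → ⟦⟧≤1 (e 0 x))
         (≤-reflexive (trans (∑-const q 1) (*-identityʳ q)))))) ⟩
  4 * (q + 0) + 18       ≤⟨ +-monoʳ-≤ (4 * (q + 0)) (m≤m+n 18 1) ⟩
  4 * (q + 0) + (9 + 5 * 2) ≤⟨ +-monoʳ-≤ (4 * (q + 0)) (+-monoʳ-≤ 9 (*-monoʳ-≤ 5 (s≤s⁻¹ 3≤q))) ⟩
  4 * (q + 0) + (9 + 5 * q) ≡⟨ solve 1 (λ q → con 4 :* (q :+ con 0) :+ (con 9 :+ con 5 :* q) :=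
                                 con 9 :* (con 1 :+ q)) refl q ⟩
  9 * (1 + q)            ∎)
  where open ≤-Reasoning

-- The enumeration, by evaluation from the empty prefix. Since fuel 12 suffices, every branch is
-- settled with at most eleven rows fixed.
search-succeeds : search 12 0 0 (λ _ _ → false) ≡ true
search-succeeds = refl

all-or-any : ∀ n {P : ℕ → ℕ} → (∃[ i ] i < n × P i < 3) ⊎ (∀ i → i < n → 3 ≤ P i)
all-or-any n {P} with anyUpTo? (λ i → P i <? 3) n
... | yes any = inj₁ any
... | no ¬any = inj₂ λ i i<n → ≮⇒≥ λ Pi<3 → ¬any (i , i<n , Pi<3)

-- Two consecutive rows or columns with at most two common entries are merged; when there are none,
-- the search decides.
good-below : ∀ n {p q e} → p + q < n → 3 ≤ p + q → Planar p q e → Good p q e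
good-below n {zero}          _ 3≤ D = few-rows z≤n 3≤
good-below n {suc zero}      _ 3≤ D = few-rows (s≤s z≤n) 3≤
good-below n {p} {zero}      _ 3≤ D = flip-good (few-rows z≤n (≤-trans 3≤ (≤-reflexive (+-comm p 0))))
good-below n {p} {suc zero}  _ 3≤ D =
  flip-good (few-rows (s≤s z≤n) (≤-trans 3≤ (≤-reflexive (+-comm p 1))))
good-below (suc n) {p@(suc p′@(suc p″))} {q@(suc q′@(suc q″))} {e} p+q≤n 3≤ D
  with all-or-any p′ {rowShare q e} | all-or-any q′ {colShare p e}
... | inj₁ (a , a<p′ , s<3) | _ =
  -- As p and q are at least 2, at least three vertices are left after the merge.
  merge-good a<p′ D (s≤s⁻¹ s<3)
    (good-below n (s≤s⁻¹ p+q≤n) (s≤s (≤-trans (s≤s (s≤s z≤n)) (m≤n+m q p″))) (merge-planar a<p′ D))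
... | inj₂ rows≥3 | inj₁ (a , a<q′ , s<3) =
  flip-good (merge-good a<q′ (flip-planar D) (s≤s⁻¹ s<3)
    (good-below n (≤-trans (≤-reflexive (trans (cong suc (+-comm q′ p)) (sym (+-suc p q′)))) (s≤s⁻¹ p+q≤n))
      (s≤s (≤-trans (s≤s (s≤s z≤n)) (m≤n+m p q″))) (merge-planar a<q′ (flip-planar D))))
... | inj₂ rows≥3 | inj₂ cols≥3 = search-true 12 empty search-succeeds
  where
  open Exploration D (s≤s (s≤s z≤n))
    (λ i i<p → rows≥3 i (s≤s⁻¹ i<p)) (λ x x<q → cols≥3 x (s≤s⁻¹ x<q))
    (λ smaller 3≤′ → good-below n (≤-trans smaller (s≤s⁻¹ p+q≤n)) 3≤′)
  empty : Prefix 0 0 λ _ _ → false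
  empty = record { k≤p = z≤n ; w≤q = z≤n ; agrees = λ () ; within = λ () }

planar-good : ∀ {p q e} → 3 ≤ p + q → Planar p q e → Good p q e
planar-good = good-below _ ≤-refl

-- Edge counts as sums over pairs of vertices

sum-∑ : ∀ {n f g} → (∀ (i : Fin n) → f i ≡ g (toℕ i)) → sum f ≡ ∑ n g
sum-∑ {zero}  f≡g = refl
sum-∑ {suc n} f≡g = cong₂ _+_ (f≡g Fin.zero) (sum-∑ (f≡g ∘ Fin.suc))

sum-split : ∀ p {q} (f : Fin (p + q) → ℕ) → sum f ≡ sum (f ∘ (_↑ˡ q)) + sum (f ∘ (p ↑ʳ_))
sum-split zero    f = refl
sum-split (suc p) f =
  trans (cong (f Fin.zero +_) (sum-split p (f ∘ Fin.suc))) (sym (+-assoc (f Fin.zero) _ _))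

length-filter² : ∀ {A : Set} {P Q : A → Set} (P? : Decidable P) (Q? : Decidable Q) xs →
  length (filter P? (filter Q? xs)) ≡ sumˡ (map (λ a → ⟦ does (P? a) ∧ does (Q? a) ⟧) xs)
length-filter² P? Q? []       = refl
length-filter² P? Q? (a ∷ xs) with does (Q? a)
... | false rewrite ∧-comm (does (P? a)) false = length-filter² P? Q? xs
... | true with does (P? a)
...   | false = length-filter² P? Q? xs
...   | true  = cong suc (length-filter² P? Q? xs)

length-filter : ∀ {A : Set} {P : A → Set} (P? : Decidable P) xs →
  length (filter P? xs) ≡ sumˡ (map (λ a → ⟦ does (P? a) ⟧) xs)
length-filter P? []       = refl
length-filter P? (a ∷ xs) with does (P? a)
... | false = length-filter P? xs
... | true  = cong suc (length-filter P? xs)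

sum-cartesianProduct : ∀ {A B : Set} (f : A × B → ℕ) xs ys →
  sumˡ (map f (cartesianProduct xs ys)) ≡ sumˡ (map (λ a → sumˡ (map (λ b → f (a , b)) ys)) xs)
sum-cartesianProduct f []       ys = refl
sum-cartesianProduct f (a ∷ xs) ys = begin
  sumˡ (map f (map (a ,_) ys ++ cartesianProduct xs ys))
    ≡⟨ cong sumˡ (map-++ f (map (a ,_) ys) _) ⟩
  sumˡ (map f (map (a ,_) ys) ++ map f (cartesianProduct xs ys))
    ≡⟨ sum-++ (map f (map (a ,_) ys)) _ ⟩
  sumˡ (map f (map (a ,_) ys)) + sumˡ (map f (cartesianProduct xs ys))
    ≡⟨ cong₂ (λ u v → sumˡ u + v) (sym (map-∘ ys)) (sum-cartesianProduct f xs ys) ⟩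
  sumˡ (map (λ b → f (a , b)) ys) + sumˡ (map (λ a → sumˡ (map (λ b → f (a , b)) ys)) xs) ∎
  where open ≡-Reasoning

sum-allFin : ∀ n (f : Fin n → ℕ) → sumˡ (map f (allFin n)) ≡ sum f
sum-allFin n f = trans (cong sumˡ (map-tabulate id f)) (go n f)
  where
  go : ∀ n (f : Fin n → ℕ) → sumˡ (tabulate f) ≡ sum f
  go zero    f = refl
  go (suc n) f = cong (f Fin.zero +_) (go n (f ∘ Fin.suc))

sum-pairs : ∀ m n (f : Fin m × Fin n → ℕ) →
  sumˡ (map f (cartesianProduct (allFin m) (allFin n))) ≡ sum λ a → sum λ b → f (a , b)
sum-pairs m n f = begin
  sumˡ (map f (cartesianProduct (allFin m) (allFin n)))
    ≡⟨ sum-cartesianProduct f (allFin m) (allFin n) ⟩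
  sumˡ (map (λ a → sumˡ (map (λ b → f (a , b)) (allFin n))) (allFin m))
    ≡⟨ sum-allFin m (λ a → sumˡ (map (λ b → f (a , b)) (allFin n))) ⟩
  (sum λ a → sumˡ (map (λ b → f (a , b)) (allFin n)))
    ≡⟨ sum-cong-≗ (λ a → sum-allFin n (λ b → f (a , b))) ⟩
  (sum λ a → sum λ b → f (a , b)) ∎
  where open ≡-Reasoning

-- The condition a < b in `edgeCount` is not stable under relabelling; the sum over all ordered
-- pairs is, and it counts every edge twice.
adjacencies : ∀ {n} → Graph n → ℕ
adjacencies G = sum λ a → sum λ b → ⟦ adj G a b ⟧

edgeCount-double : ∀ {n} (G : Graph n) → edgeCount G + edgeCount G ≡ adjacencies G
edgeCount-double {n} G = begin
  edgeCount G + edgeCount G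
    ≡⟨ cong₂ _+_ up (trans up (∑-comm F)) ⟩
  (sum λ a → sum λ b → F a b) + (sum λ a → sum λ b → F b a)
    ≡⟨ ∑-distrib-+ (λ a → sum λ b → F a b) (λ a → sum λ b → F b a) ⟨
  (sum λ a → sum (λ b → F a b) + sum (λ b → F b a))
    ≡⟨ sum-cong-≗ (λ a → trans (sym (∑-distrib-+ (λ b → F a b) (λ b → F b a))) (sum-cong-≗ (either a))) ⟩
  adjacencies G ∎
  where
  open ≡-Reasoning
  F : Fin n → Fin n → ℕ
  F a b = ⟦ (toℕ a <ᵇ toℕ b) ∧ adj G a b ⟧
  up : edgeCount G ≡ sum λ a → sum λ b → F a b
  up = trans (length-filter _ (cartesianProduct (allFin n) (allFin n))) (sum-pairs n n _)
  either : ∀ a b → F a b + F b a ≡ ⟦ adj G a b ⟧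
  either a b rewrite Graph.sym G b a with toℕ a <ᵇ toℕ b in a<b | toℕ b <ᵇ toℕ a in b<a
  ... | true  | true  = ⊥-elim (<-asym (<ᵇ⇒< (toℕ a) _ (subst T (sym a<b) tt))
                                       (<ᵇ⇒< (toℕ b) _ (subst T (sym b<a) tt)))
  ... | true  | false = +-identityʳ _
  ... | false | true  = refl
  -- Neither a < b nor b < a leaves a = b, where `irrefl` makes both sides zero.
  ... | false | false
    with refl ← toℕ-injective {i = a} {b} (≤-antisym (≮⇒≥ λ lt → subst T b<a (<⇒<ᵇ lt))
                                                     (≮⇒≥ λ lt → subst T a<b (<⇒<ᵇ lt))) =
    cong ⟦_⟧ (sym (Graph.irrefl G a))

adjacencies-≅ : ∀ {m n} {G : Graph m} {H : Graph n} → G ≅ H → adjacencies G ≡ adjacencies H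
adjacencies-≅ {G = G} {H} (σ , G≡H) = begin
  (sum λ a → sum λ b → ⟦ adj G a b ⟧)
    ≡⟨ sum-cong-≗ (λ a → sum-cong-≗ λ b → cong ⟦_⟧ (G≡H a b)) ⟩
  (sum λ a → sum λ b → ⟦ adj H (σ ⟨$⟩ʳ a) (σ ⟨$⟩ʳ b) ⟧)
    ≡⟨ sum-cong-≗ (λ a → sum-permute (λ b → ⟦ adj H (σ ⟨$⟩ʳ a) b ⟧) σ) ⟨
  (sum λ a → sum λ b → ⟦ adj H (σ ⟨$⟩ʳ a) b ⟧)
    ≡⟨ sum-permute (λ a → sum λ b → ⟦ adj H a b ⟧) σ ⟨
  adjacencies H ∎
  where open ≡-Reasoning

-- From drawings to matrices

matrix : ∀ {p q} → TwoLayer p q → Matrix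
matrix {p} {q} D i x with i <? p | x <? q
... | yes i<p | yes x<q = E D (fromℕ< i<p) (fromℕ< x<q)
... | yes _   | no  _   = false
... | no  _   | _       = false

matrix-toℕ : ∀ {p q} (D : TwoLayer p q) u v → matrix D (toℕ u) (toℕ v) ≡ E D u v
matrix-toℕ {p} {q} D u v with toℕ u <? p | toℕ v <? q
... | yes u<p | yes v<q = cong₂ (E D) (fromℕ<-toℕ u u<p) (fromℕ<-toℕ v v<q)
... | yes _   | no  v≮q = contradiction (toℕ<n v) v≮q
... | no  u≮p | _       = contradiction (toℕ<n u) u≮p

matrix-entry : ∀ {p q} (D : TwoLayer p q) {i x} → T (matrix D i x) →
               ∃[ u ] ∃[ v ] toℕ u ≡ i × toℕ v ≡ x × T (E D u v)
matrix-entry {p} {q} D {i} {x} t with i <? p | x <? q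
... | yes i<p | yes x<q = fromℕ< i<p , fromℕ< x<q , toℕ-fromℕ< i<p , toℕ-fromℕ< x<q , t

matrix-planar : ∀ {p q} {D : TwoLayer p q} → IsPlanar 5 D → Planar p q (matrix D)
matrix-planar {p} {q} {D} planar = record { inside = inside′ ; sparse = sparse′ }
  where
  inside′ : ∀ {i x} → T (matrix D i x) → i < p × x < q
  inside′ t with u , v , refl , refl , _ ← matrix-entry D t = toℕ<n u , toℕ<n v
  crossed≡ : ∀ u v → crossings D (u , v) ≡ crossed p q (matrix D) (toℕ u) (toℕ v)
  crossed≡ u v = trans
    (length-filter² (cross? (u , v)) (λ (u , v) → T? (E D u v)) (cartesianProduct (allFin p) (allFin q)))
    (trans (sum-pairs p q _) (sum-∑ λ j → sum-∑ λ y →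
      cong (λ b → ⟦ cross (toℕ u) (toℕ v) (toℕ j) (toℕ y) ∧ b ⟧) (sym (matrix-toℕ D j y))))
  sparse′ : ∀ {i x} → T (matrix D i x) → crossed p q (matrix D) i x ≤ 5
  sparse′ t with u , v , refl , refl , uv ← matrix-entry D t =
    ≤-trans (≤-reflexive (sym (crossed≡ u v))) (planar u v uv)

-- In the block form given by the two layers, the diagonal blocks vanish and each of the others
-- contains every edge once.
adjacencies-underlying : ∀ {p q} (D : TwoLayer p q) →
  adjacencies (underlying D) ≡ count p q (matrix D) + count p q (matrix D)
adjacencies-underlying {p} {q} D = begin
  adjacencies (underlying D)
    ≡⟨ sum-split p (λ a → sum λ b → ⟦ adj (underlying D) a b ⟧) ⟩
  (sum λ u → sum λ b → ⟦ adj (underlying D) (u ↑ˡ q) b ⟧) +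
  (sum λ v → sum λ b → ⟦ adj (underlying D) (p ↑ʳ v) b ⟧)
    ≡⟨ cong₂ _+_ (sum-cong-≗ fromU) (sum-cong-≗ fromV) ⟩
  (sum λ u → sum λ v → ⟦ E D u v ⟧) + (sum λ v → sum λ u → ⟦ E D u v ⟧)
    ≡⟨ cong₂ _+_ edges≡ (trans (∑-comm (λ v u → ⟦ E D u v ⟧)) edges≡) ⟩
  count p q (matrix D) + count p q (matrix D) ∎
  where
  open ≡-Reasoning
  edges≡ : (sum λ u → sum λ v → ⟦ E D u v ⟧) ≡ count p q (matrix D)
  edges≡ = sum-∑ λ u → sum-∑ λ v → cong ⟦_⟧ (sym (matrix-toℕ D u v))
  sum-0 : ∀ {n} {f : Fin n → ℕ} → (∀ i → f i ≡ 0) → sum f ≡ 0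
  sum-0 {n} f≡0 = trans (sum-∑ f≡0) (∑-zero n λ _ _ → refl)
  fromU : ∀ u → sum (λ b → ⟦ adj (underlying D) (u ↑ˡ q) b ⟧) ≡ sum λ v → ⟦ E D u v ⟧
  fromU u = trans (sum-split p _) (cong₂ _+_ (sum-0 uu) (sum-cong-≗ uv))
    where
    uu : ∀ u′ → ⟦ adj (underlying D) (u ↑ˡ q) (u′ ↑ˡ q) ⟧ ≡ 0
    uu u′ rewrite splitAt-↑ˡ p u q | splitAt-↑ˡ p u′ q = refl
    uv : ∀ v → ⟦ adj (underlying D) (u ↑ˡ q) (p ↑ʳ v) ⟧ ≡ ⟦ E D u v ⟧
    uv v rewrite splitAt-↑ˡ p u q | splitAt-↑ʳ p q v = refl
  fromV : ∀ v → sum (λ b → ⟦ adj (underlying D) (p ↑ʳ v) b ⟧) ≡ sum λ u → ⟦ E D u v ⟧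
  fromV v = trans (sum-split p _)
    (trans (cong₂ _+_ (sum-cong-≗ vu) (sum-0 vv)) (+-identityʳ _))
    where
    vu : ∀ u → ⟦ adj (underlying D) (p ↑ʳ v) (u ↑ˡ q) ⟧ ≡ ⟦ E D u v ⟧
    vu u rewrite splitAt-↑ʳ p q v | splitAt-↑ˡ p u q = refl
    vv : ∀ v′ → ⟦ adj (underlying D) (p ↑ʳ v) (p ↑ʳ v′) ⟧ ≡ 0
    vv v′ rewrite splitAt-↑ʳ p q v | splitAt-↑ʳ p q v′ = refl

double-injective : ∀ {m n} → m + m ≡ n + n → m ≡ n
double-injective {zero}  {zero}  _  = refl
double-injective {suc m} {suc n} eq = cong suc (double-injective (suc-injective
  (trans (sym (+-suc m m)) (trans (suc-injective eq) (+-suc n n)))))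

edgeCount-drawing : ∀ {n p q} {G : Graph n} {D : TwoLayer p q} → G ≅ underlying D →
                    edgeCount G ≡ count p q (matrix D)
edgeCount-drawing {p = p} {q} {G} {D} iso = double-injective (begin
  edgeCount G + edgeCount G                     ≡⟨ edgeCount-double G ⟩
  adjacencies G                                 ≡⟨ adjacencies-≅ {G = G} {underlying D} iso ⟩
  adjacencies (underlying D)                    ≡⟨ adjacencies-underlying D ⟩
  count p q (matrix D) + count p q (matrix D)   ∎)
  where open ≡-Reasoning

underlying-cong : ∀ {p q} {D D′ : TwoLayer p q} → (∀ u v → E D u v ≡ E D′ u v) →
                  ∀ a b → adj (underlying D) a b ≡ adj (underlying D′) a b
underlying-cong {p} D≡D′ a b with splitAt p a | splitAt p b
... | inj₁ _ | inj₁ _ = refl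
... | inj₁ u | inj₂ v = D≡D′ u v
... | inj₂ v | inj₁ u = D≡D′ u v
... | inj₂ _ | inj₂ _ = refl

𝒮-edge-matrix : ∀ u v → 𝒮-matrix (toℕ u) (toℕ v) ≡ 𝒮-edge u v
𝒮-edge-matrix = toWitness {a? = all? λ u → all? λ v → 𝒮-matrix (toℕ u) (toℕ v) ≟ᵇ 𝒮-edge u v} tt

-- The bound over the rationals

open import Data.Integer.Base as ℤ using (+_)
import Data.Integer.Properties as ℤP
open import Data.Rational.Base as ℚ using (_/_; toℚᵘ)
import Data.Rational.Properties as ℚP
import Data.Rational.Unnormalised.Base as ℚᵘ
import Data.Rational.Unnormalised.Properties as ℚᵘP

-- The comparison of m with 9/4 n - 9/2 after clearing the denominators 1 and 4 * 1 * 2, in the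
-- shape to which the order of unnormalised rationals unfolds.
integral-bound : ∀ m n → 4 * m + 18 ≤ 9 * n →
  + m ℤ.* + 8 ℤ.≤ (+ 9 ℤ.* + n ℤ.* + 2 ℤ.+ ℤ.-[1+ 8 ] ℤ.* + 4) ℤ.* + 1
integral-bound m n h = begin
  + m ℤ.* + 8                       ≡⟨ ℤP.pos-* m 8 ⟨
  + (m * 8)                         ≡⟨ ℤP.+-identityʳ (+ (m * 8)) ⟨
  -- Adding and cancelling 36 brings in twice the hypothesis, as a statement on naturals.
  + (m * 8) ℤ.+ (+ 36 ℤ.+ ℤ.- + 36) ≡⟨ ℤP.+-assoc (+ (m * 8)) (+ 36) (ℤ.- + 36) ⟨
  + (m * 8 + 36) ℤ.+ ℤ.- + 36       ≤⟨ ℤP.+-monoˡ-≤ (ℤ.- + 36) (ℤ.+≤+ doubled) ⟩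
  + (9 * n * 2) ℤ.+ ℤ.- + 36
    ≡⟨ cong (ℤ._+ ℤ.- + 36) (trans (ℤP.pos-* (9 * n) 2) (cong (ℤ._* + 2) (ℤP.pos-* 9 n))) ⟩
  + 9 ℤ.* + n ℤ.* + 2 ℤ.+ ℤ.- + 36  ≡⟨ ℤP.*-identityʳ _ ⟨
  (+ 9 ℤ.* + n ℤ.* + 2 ℤ.+ ℤ.-[1+ 8 ] ℤ.* + 4) ℤ.* + 1 ∎
  where
  open ℤP.≤-Reasoning
  doubled : m * 8 + 36 ≤ 9 * n * 2
  doubled = ≤-trans (≤-reflexive (solve 1 (λ m → m :* con 8 :+ con 36 :=
                                                 (con 4 :* m :+ con 18) :* con 2) refl m))
                    (*-monoˡ-≤ 2 h)

-- Since `_/_` cancels a gcd and so does not compute for variable m and n, the inequality is proved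
-- for unnormalised fractions and pulled back.
rational-bound : ∀ m n → 4 * m + 18 ≤ 9 * n → + m / 1 ℚ.≤ (+ 9 / 4) ℚ.* (+ n / 1) ℚ.- (+ 9 / 2)
rational-bound m n h = ℚP.toℚᵘ-cancel-≤ (begin
  toℚᵘ (+ m / 1)                                     ≃⟨ ℚP.toℚᵘ-fromℚᵘ (ℚᵘ.mkℚᵘ (+ m) 0) ⟩
  ℚᵘ.mkℚᵘ (+ m) 0                                    ≤⟨ ℚᵘ.*≤* integral ⟩
  nine-quarters ℚᵘ.* ℚᵘ.mkℚᵘ (+ n) 0 ℚᵘ.- nine-halves
    ≃⟨ ℚᵘP.+-congˡ (ℚᵘ.- nine-halves) (ℚᵘP.*-congˡ {nine-quarters} (ℚP.toℚᵘ-fromℚᵘ (ℚᵘ.mkℚᵘ (+ n) 0))) ⟨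
  nine-quarters ℚᵘ.* toℚᵘ (+ n / 1) ℚᵘ.- nine-halves
    ≃⟨ ℚᵘP.+-congˡ (ℚᵘ.- nine-halves) (ℚP.toℚᵘ-homo-* (+ 9 / 4) (+ n / 1)) ⟨
  toℚᵘ ((+ 9 / 4) ℚ.* (+ n / 1)) ℚᵘ.- nine-halves
    ≃⟨ ℚP.toℚᵘ-homo-+ ((+ 9 / 4) ℚ.* (+ n / 1)) (ℚ.- (+ 9 / 2)) ⟨
  toℚᵘ ((+ 9 / 4) ℚ.* (+ n / 1) ℚ.- (+ 9 / 2)) ∎)
  where
  open ℚᵘP.≤-Reasoning
  nine-quarters = ℚᵘ.mkℚᵘ (+ 9) 3
  nine-halves   = ℚᵘ.mkℚᵘ (+ 9) 1
  integral : + m ℤ.* + 8 ℤ.≤ (+ 9 ℤ.* + n ℤ.* + 2 ℤ.+ ℤ.-[1+ 8 ] ℤ.* + 4) ℤ.* + 1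
  integral = integral-bound m n h

theorem8 : (∀ (n : ℕ) (G : Graph n) → n ≥ 3 → IsTwoLayerPlanar 5 G →
    (+ edgeCount G / 1 ℚ.≤ (+ 9 / 4) ℚ.* (+ n / 1) ℚ.- (+ 9 / 2)) ⊎ (G ≅ 𝒮))
    × IsTwoLayerPlanar 5 𝒮
    × (edgeCount 𝒮 ≡ 14)
    × (¬ (+ edgeCount 𝒮 / 1 ℚ.≤ (+ 9 / 4) ℚ.* (+ 8 / 1) ℚ.- (+ 9 / 2)))
theorem8 = bounded , (4 , 4 , twoLayer 𝒮-edge , 𝒮-planar , idᵖ , λ _ _ → refl) , refl , dense
  where
  bounded : ∀ (n : ℕ) (G : Graph n) → n ≥ 3 → IsTwoLayerPlanar 5 G →
    (+ edgeCount G / 1 ℚ.≤ (+ 9 / 4) ℚ.* (+ n / 1) ℚ.- (+ 9 / 2)) ⊎ (G ≅ 𝒮)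
  -- A permutation between the vertex sets forces n = p + q.
  bounded n G n≥3 (p , q , D , planar , iso@(σ , G≡D)) with refl ← ↔⇒≡ σ
    with planar-good n≥3 (matrix-planar planar)
  ... | inj₁ h = inj₁ (rational-bound (edgeCount G) (p + q)
    (subst (λ m → 4 * m + 18 ≤ 9 * (p + q)) (sym (edgeCount-drawing {p = p} {q} {G} {D} iso)) h))
  -- The drawing has the adjacencies of 𝒮 position by position, so the given σ is already an
  -- isomorphism onto 𝒮.
  ... | inj₂ s with refl ← p≡4 s | refl ← q≡4 s = inj₂ (σ , λ a b → trans (G≡D a b)
    (underlying-cong {D = D} {twoLayer 𝒮-edge} (λ u v → trans (sym (matrix-toℕ D u v))
      (trans (agree s (toℕ<n u) (toℕ<n v)) (𝒮-edge-matrix u v))) (σ ⟨$⟩ʳ a) (σ ⟨$⟩ʳ b)))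
  𝒮-planar : IsPlanar 5 (twoLayer 𝒮-edge)
  𝒮-planar = toWitness
    {a? = all? λ u → all? λ v → T? (𝒮-edge u v) →-dec crossings (twoLayer 𝒮-edge) (u , v) ≤? 5} tt
  -- The right-hand side is 18 - 9/2 = 27/2, just below 14.
  dense : ¬ (+ edgeCount 𝒮 / 1 ℚ.≤ (+ 9 / 4) ℚ.* (+ 8 / 1) ℚ.- (+ 9 / 2))
  dense = toWitnessFalse {a? = + edgeCount 𝒮 / 1 ℚP.≤? (+ 9 / 4) ℚ.* (+ 8 / 1) ℚ.- (+ 9 / 2)} tt
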